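{- Let $n\geq 1$. For every permutation $\sigma\in\mathfrak{S}_{n+1}$ we have $$|C(\sigma)|\leq \frac{1}{2}|R(\sigma)|+1.$$
   Context: $\mathfrak{S}_{n+1}$ is the symmetric group on $[n+1]=\{1,\ldots,n+1\}$, with product given by composition of functions read from the right; it is generated by $s_i=(i\ \ i+1)$, $i\in[n]$. A reduced word of $\sigma$ is a word $i_1i_2\cdots i_l$ with letters in $[n]$ such that $\sigma=s_{i_1}s_{i_2}\cdots s_{i_l}$ with $l$ minimal. $R(\sigma)$ is the set of reduced words of $\sigma$. A commutation replaces two consecutive letters $ij$ of a word, with $|i-j|>1$, by $ji$. Two reduced words of $\sigma$ are equivalent if they differ by a sequence of commutations; the equivalence classes are the commutation classes of $\sigma$, and $C(\sigma)$ denotes the set of all commutation classes of $\sigma$. -}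

module Defs where

open import Level using (Level; 0ℓ; _⊔_)
open import Data.Nat using (ℕ; suc; _≤_; _>_; ∣_-_∣)
open import Data.Fin using (Fin; suc; inject₁; toℕ)
open import Data.Fin.Permutation using (Permutation′; transpose; id; _∘ₚ_; _≈_)
open import Data.List using (List; []; _∷_; _++_; length)
open import Data.Product using (Σ; _×_; proj₁)
open import Function.Bundles using (Bijection)
open import Relation.Binary.Core using (Rel)
open import Relation.Binary.Bundles using (Setoid)
open import Relation.Binary.PropositionalEquality using (setoid)
import Relation.Binary.Construct.Closure.Equivalence as EqC
import Relation.Binary.Construct.On as On

-- Points and letters are numbered from 0: the symmetric group on [n+1] is
-- Permutation′ (suc n), and i : Fin n stands for the letter toℕ i + 1 of [n].

Word : ℕ → Set
Word n = List (Fin n)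

s : ∀ {n} → Fin n → Permutation′ (suc n)
s i = transpose (inject₁ i) (suc i)

-- π ∘ₚ ρ applies π first, so s i acts after ⟦ w ⟧: products of generators are
-- composed as functions read from the right.
⟦_⟧ : ∀ {n} → Word n → Permutation′ (suc n)
⟦ [] ⟧    = id
⟦ i ∷ w ⟧ = ⟦ w ⟧ ∘ₚ s i

IsReducedWord : ∀ {n} → Permutation′ (suc n) → Word n → Set
IsReducedWord {n} σ w =
  σ ≈ ⟦ w ⟧ × ((v : Word n) → σ ≈ ⟦ v ⟧ → length w ≤ length v)

data Commutation {n} : Rel (Word n) 0ℓ where
  commute : ∀ (u : Word n) {i j : Fin n} (v : Word n) → ∣ toℕ i - toℕ j ∣ > 1 →
            Commutation (u ++ i ∷ j ∷ v) (u ++ j ∷ i ∷ v)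

ReducedWord : ∀ {n} → Permutation′ (suc n) → Set
ReducedWord {n} σ = Σ (Word n) (IsReducedWord σ)

-- Reduced words are compared as words; the proof of reducedness is ignored.
R : ∀ {n} → Permutation′ (suc n) → Setoid 0ℓ 0ℓ
R {n} σ = On.setoid {B = ReducedWord σ} (setoid (Word n)) proj₁

-- The set of commutation classes, as a quotient of the reduced words of σ.
-- A commutation changes neither the length nor the permutation, so every word
-- in a sequence of commutations starting at a reduced word of σ is again one.
C : ∀ {n} → Permutation′ (suc n) → Setoid 0ℓ 0ℓ
C σ = On.setoid {B = ReducedWord σ} (EqC.setoid Commutation) proj₁

HasCardinality : ∀ {a ℓ : Level} → Setoid a ℓ → ℕ → Set (a ⊔ ℓ)
HasCardinality S k = Bijection S (setoid (Fin k))

{-# OPTIONS --safe #-}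
module Submission where

-- A commutation class is a single word exactly when that word is a walk, that
-- is, when consecutive letters differ by 1.  Twice the number of classes is
-- bounded by injecting two tokens per class into the reduced words plus two
-- extra points.
--
-- Call a word mixed if its first commuting pair ac occurs as x·ac·b·ac·y.  A
-- class that is not a single word contains two words that are neither walks nor
-- mixed: if x·acbac·y is in it, then so are x·acbca·y and x·cabac·y.  These are
-- its tokens.  A walk w is its own first token.  If w = x·abcba·y with a ≠ c,
-- then x·acbac·y, obtained by a braid move and a commutation, is a mixed reduced
-- word from which w can be recovered; it is the second token.
--
-- The remaining walks also avoid abab, so up to one extra letter at either end
-- they are monotone runs.  At most one of them is essentially increasing and at
-- most one essentially decreasing: the run from a to b sends b + 1 to a, which
-- determines a and b.  Their second tokens are the two extra points.

open import Defs
open import Data.Empty using (⊥-elim)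
open import Data.Fin as Fin using (Fin; zero; suc; toℕ; inject₁; fromℕ<)
open import Data.Fin.Permutation using (Permutation′; _≈_; _⟨$⟩ʳ_)
import Data.Fin.Properties as Fin
open import Data.Fin.Properties using (toℕ-injective)
open import Data.Integer using (+_)
open import Data.List
  using (List; []; _∷_; [_]; _++_; _∷ʳ_; allFin; cartesianProductWith; filter; foldr; length; map; reverse)
open import Data.List.Properties
open import Data.Nat using (ℕ; zero; suc) renaming (_≤_ to _≤ℕ_)
open import Data.Nat.Properties
open import Data.Product using (Σ; _×_; _,_; proj₁; proj₂; ∃-syntax; map₂)
open import Data.Sum as Sum using (_⊎_; inj₁; inj₂)
open import Function using (_∘_; case_of_)
open import Relation.Binary.Construct.Closure.Equivalence as EqC using (EqClosure)
open import Relation.Binary.PropositionalEquality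
  using (_≡_; _≢_; refl; sym; trans; cong; cong₂; subst; subst₂; ≢-sym; isEquivalence; module ≡-Reasoning)
open import Relation.Nullary using (¬_; Dec; yes; no; contradiction)
open import Relation.Nullary.Decidable using (map′; ¬?; _×-dec_; _→-dec_)

-- Adjacent transpositions acting on the natural numbers.

module AdjacentTranspositions where

  open import Data.Nat using (_+_; _≤_; _<_; _>_; z≤n; s≤s; z<s; ∣_-_∣)

  -- Taken on all of ℕ there is no upper bound to carry along, and the braid and commutation
  -- relations follow by structural recursion from a few closed cases.
  swap : ℕ → ℕ → ℕ
  swap zero    zero          = 1
  swap zero    (suc zero)    = 0
  swap zero    (suc (suc x)) = suc (suc x)
  swap (suc i) zero          = zero
  swap (suc i) (suc x)       = suc (swap i x)

  swap-left : ∀ i → swap i i ≡ suc i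
  swap-left zero    = refl
  swap-left (suc i) = cong suc (swap-left i)

  swap-right : ∀ i → swap i (suc i) ≡ i
  swap-right zero    = refl
  swap-right (suc i) = cong suc (swap-right i)

  swap-fix : ∀ i x → x ≢ i → x ≢ suc i → swap i x ≡ x
  swap-fix zero    zero          x≢i x≢1+i = contradiction refl x≢i
  swap-fix zero    (suc zero)    x≢i x≢1+i = contradiction refl x≢1+i
  swap-fix zero    (suc (suc x)) x≢i x≢1+i = refl
  swap-fix (suc i) zero          x≢i x≢1+i = refl
  swap-fix (suc i) (suc x)       x≢i x≢1+i =
    cong suc (swap-fix i x (λ eq → x≢i (cong suc eq)) (λ eq → x≢1+i (cong suc eq)))

  swap-below : ∀ {i x} → x < i → swap i x ≡ x
  swap-below x<i = swap-fix _ _ (<⇒≢ x<i) (<⇒≢ (m<n⇒m<1+n x<i))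

  swap-above : ∀ {i x} → suc i < x → swap i x ≡ x
  swap-above 1+i<x = swap-fix _ _ (≢-sym (<⇒≢ (<-trans (n<1+n _) 1+i<x))) (≢-sym (<⇒≢ 1+i<x))

  swap-involutive : ∀ i x → swap i (swap i x) ≡ x
  swap-involutive zero    zero          = refl
  swap-involutive zero    (suc zero)    = refl
  swap-involutive zero    (suc (suc x)) = refl
  swap-involutive (suc i) zero          = refl
  swap-involutive (suc i) (suc x)       = cong suc (swap-involutive i x)

  swap-braid : ∀ i x →
    swap i (swap (suc i) (swap i x)) ≡ swap (suc i) (swap i (swap (suc i) x))
  swap-braid zero    zero                = refl
  swap-braid zero    (suc zero)          = refl
  swap-braid zero    (suc (suc zero))    = refl
  swap-braid zero    (suc (suc (suc x))) = refl
  swap-braid (suc i) zero                = refl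
  swap-braid (suc i) (suc x)             = cong suc (swap-braid i x)

  swap-comm : ∀ i j x → ∣ i - j ∣ > 1 → swap i (swap j x) ≡ swap j (swap i x)
  swap-comm zero          (suc zero)    x             (s≤s ())
  swap-comm zero          (suc (suc j)) zero          far = refl
  swap-comm zero          (suc (suc j)) (suc zero)    far = refl
  swap-comm zero          (suc (suc j)) (suc (suc x)) far = refl
  swap-comm (suc zero)    zero          x             (s≤s ())
  swap-comm (suc (suc i)) zero          zero          far = refl
  swap-comm (suc (suc i)) zero          (suc zero)    far = refl
  swap-comm (suc (suc i)) zero          (suc (suc x)) far = refl
  swap-comm (suc i)       (suc j)       zero          far = refl
  swap-comm (suc i)       (suc j)       (suc x)       far = cong suc (swap-comm i j x far)

  swap-drop : ∀ i x → x ≤ suc (swap i x)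
  swap-drop zero    zero          = z≤n
  swap-drop zero    (suc zero)    = s≤s z≤n
  swap-drop zero    (suc (suc x)) = n≤1+n _
  swap-drop (suc i) zero          = z≤n
  swap-drop (suc i) (suc x)       = s≤s (swap-drop i x)

  swap-nondrop : ∀ i x → x ≢ suc i → x ≤ swap i x
  swap-nondrop zero    zero          x≢1+i = z≤n
  swap-nondrop zero    (suc zero)    x≢1+i = contradiction refl x≢1+i
  swap-nondrop zero    (suc (suc x)) x≢1+i = ≤-refl
  swap-nondrop (suc i) zero          x≢1+i = z≤n
  swap-nondrop (suc i) (suc x)       x≢1+i = s≤s (swap-nondrop i x (λ eq → x≢1+i (cong suc eq)))

  swap-≡ : ∀ i x → swap i x ≡ i → x ≡ suc i
  swap-≡ i x eq = trans (sym (swap-involutive i x)) (trans (cong (swap i) eq) (swap-left i))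

  act : List ℕ → ℕ → ℕ
  act w x = foldr swap x w

  act-++ : ∀ u v x → act (u ++ v) x ≡ act u (act v x)
  act-++ []      v x = refl
  act-++ (i ∷ u) v x = cong (swap i) (act-++ u v x)

  act-reverse : ∀ w x → act (reverse w) (act w x) ≡ x
  act-reverse []      x = refl
  act-reverse (i ∷ w) x = begin
    act (reverse (i ∷ w)) y            ≡⟨ cong (λ v → act v y) (unfold-reverse i w) ⟩
    act (reverse w ∷ʳ i) y             ≡⟨ act-++ (reverse w) [ i ] y ⟩
    act (reverse w) (swap i y)         ≡⟨ cong (act (reverse w)) (swap-involutive i _) ⟩
    act (reverse w) (act w x)          ≡⟨ act-reverse w x ⟩
    x                                  ∎
    where open ≡-Reasoning
          y = swap i (act w x)

  infix 4 _≐_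
  _≐_ : List ℕ → List ℕ → Set
  u ≐ v = ∀ x → act u x ≡ act v x

  act-reverse′ : ∀ w x → act w (act (reverse w) x) ≡ x
  act-reverse′ w x = begin
    act w (act (reverse w) x)                     ≡⟨ cong (λ v → act v (act (reverse w) x)) (sym (reverse-involutive w)) ⟩
    act (reverse (reverse w)) (act (reverse w) x) ≡⟨ act-reverse (reverse w) x ⟩
    x                                             ∎
    where open ≡-Reasoning

  -- A reversed word represents the inverse permutation. This transfers uniqueness from ascending to
  -- descending runs.
  ≐-reverse : ∀ u v → u ≐ v → reverse u ≐ reverse v
  ≐-reverse u v u≐v x = begin
    act (reverse u) x                             ≡⟨ cong (act (reverse u)) (sym (act-reverse′ v x)) ⟩
    act (reverse u) (act v (act (reverse v) x))   ≡⟨ cong (act (reverse u)) (sym (u≐v _)) ⟩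
    act (reverse u) (act u (act (reverse v) x))   ≡⟨ act-reverse u _ ⟩
    act (reverse v) x                             ∎
    where open ≡-Reasoning

  -- Monotone runs with extra letters at the ends, and their uniqueness.

  upFrom : ℕ → ℕ → List ℕ
  upFrom a zero    = [ a ]
  upFrom a (suc k) = a ∷ upFrom (suc a) k

  -- The first argument is again the lowest letter, so reversal keeps both parameters of a run.
  downTo : ℕ → ℕ → List ℕ
  downTo a zero    = [ a ]
  downTo a (suc k) = suc (a + k) ∷ downTo a k

  length-upFrom : ∀ a k → length (upFrom a k) ≡ suc k
  length-upFrom a zero    = refl
  length-upFrom a (suc k) = cong suc (length-upFrom (suc a) k)

  downTo-∷ʳ : ∀ a k → downTo a (suc k) ≡ downTo (suc a) k ∷ʳ a
  downTo-∷ʳ a zero    = cong (λ b → suc b ∷ a ∷ []) (+-identityʳ a)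
  downTo-∷ʳ a (suc k) = cong₂ _∷_ (cong suc (+-suc a k)) (downTo-∷ʳ a k)

  reverse-downTo : ∀ a k → reverse (downTo a k) ≡ upFrom a k
  reverse-downTo a zero    = refl
  reverse-downTo a (suc k) = begin
    reverse (downTo a (suc k))      ≡⟨ cong reverse (downTo-∷ʳ a k) ⟩
    reverse (downTo (suc a) k ∷ʳ a) ≡⟨ reverse-++ (downTo (suc a) k) [ a ] ⟩
    a ∷ reverse (downTo (suc a) k)  ≡⟨ cong (a ∷_) (reverse-downTo (suc a) k) ⟩
    upFrom a (suc k)                ∎
    where open ≡-Reasoning

  upFrom-top : ∀ a k → act (upFrom a k) (suc (a + k)) ≡ a
  upFrom-top a zero    = trans (cong (λ b → swap a (suc b)) (+-identityʳ a)) (swap-right a)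
  upFrom-top a (suc k) = begin
    swap a (act (upFrom (suc a) k) (suc (a + suc k)))   ≡⟨ cong (λ b → swap a (act (upFrom (suc a) k) (suc b))) (+-suc a k) ⟩
    swap a (act (upFrom (suc a) k) (suc (suc a + k)))   ≡⟨ cong (swap a) (upFrom-top (suc a) k) ⟩
    swap a (suc a)                                      ≡⟨ swap-right a ⟩
    a                                                   ∎
    where open ≡-Reasoning

  upFrom-below : ∀ a k {x} → x < a → act (upFrom a k) x ≡ x
  upFrom-below a zero    x<a = swap-below x<a
  upFrom-below a (suc k) x<a =
    trans (cong (swap a) (upFrom-below (suc a) k (m<n⇒m<1+n x<a))) (swap-below x<a)

  upFrom-bottom : ∀ a k → act (upFrom a k) a ≡ suc a
  upFrom-bottom a zero    = swap-left a
  upFrom-bottom a (suc k) = trans (cong (swap a) (upFrom-below (suc a) k ≤-refl)) (swap-left a)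

  -- The second component carries the induction: the letter prepended next is one less than the
  -- current lowest letter `a`, and `a` is the only point that it lowers.
  upFrom-nondrop : ∀ a k x → x ≢ suc (a + k) →
    x ≤ act (upFrom a k) x × act (upFrom a k) x ≢ a
  upFrom-nondrop a zero x x≢top =
    swap-nondrop a x x≢1+a , λ eq → x≢1+a (swap-≡ a x eq)
    where x≢1+a = λ x≡1+a → x≢top (trans x≡1+a (cong suc (sym (+-identityʳ a))))
  upFrom-nondrop a (suc k) x x≢top
    with x≤y , y≢1+a ← upFrom-nondrop (suc a) k x
                         (λ eq → x≢top (trans eq (cong suc (sym (+-suc a k))))) =
    ≤-trans x≤y (swap-nondrop a _ y≢1+a) , λ eq → y≢1+a (swap-≡ a _ eq)

  -- The run from a to a + k with e extra letters at its ends.  With p = 0 and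
  -- q = 1, or the other way round, the coincidence of front and back in the
  -- permutation (a a+2) is excluded.
  data Up (p q : ℕ) : (a k e : ℕ) → List ℕ → Set where
    plain : ∀ a k → Up p q a k 0 (upFrom a k)
    front : ∀ a k → p ≤ k → Up p q a (suc k) 1 (suc a ∷ upFrom a (suc k))
    back  : ∀ a k → q ≤ k → Up p q a (suc k) 1 (upFrom a (suc k) ∷ʳ (a + k))
    both  : ∀ a k → Up p q a (2 + k) 2 (suc a ∷ upFrom a (2 + k) ∷ʳ suc (a + k))

  module _ {p q : ℕ} where

    Up-length : ∀ {a k e w} → Up p q a k e w → length w ≡ suc k + e
    Up-length (plain a k) = trans (length-upFrom a k) (cong suc (sym (+-identityʳ k)))
    Up-length (front a k _) = cong suc (trans (length-upFrom a (suc k)) (+-comm 1 (suc k)))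
    Up-length (back a k _) =
      trans (length-++ (upFrom a (suc k))) (cong (_+ 1) (length-upFrom a (suc k)))
    Up-length (both a k) = cong suc (trans (length-++ (upFrom a (2 + k)))
      (trans (cong (_+ 1) (length-upFrom a (2 + k))) (sym (+-suc (2 + k) 1))))

    Up-extra : ∀ {a k e w} → Up p q a k e w → e ≤ k
    Up-extra (plain a k)   = z≤n
    Up-extra (front a k _) = s≤s z≤n
    Up-extra (back a k _)  = s≤s z≤n
    Up-extra (both a k)    = s≤s (s≤s z≤n)

    private
      fix-top : ∀ a k → swap (a + k) (suc (a + suc k)) ≡ suc (a + suc k)
      fix-top a k = swap-above (s≤s (≤-reflexive (sym (+-suc a k))))

      back-top : ∀ a k → act (upFrom a (suc k) ∷ʳ (a + k)) (suc (a + suc k)) ≡ a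
      back-top a k = trans (act-++ (upFrom a (suc k)) [ a + k ] _)
        (trans (cong (act (upFrom a (suc k))) (fix-top a k)) (upFrom-top a (suc k)))

      back-drop : ∀ a k x → x ≢ suc (a + suc k) → x ≤ act (upFrom a (suc k) ∷ʳ (a + k)) x + 1
      back-drop a k x x≢top = begin
        x                                              ≤⟨ swap-drop (a + k) x ⟩
        suc y                                          ≤⟨ s≤s (proj₁ (upFrom-nondrop a (suc k) y y≢top)) ⟩
        suc (act (upFrom a (suc k)) y)                 ≡⟨ +-comm 1 _ ⟩
        act (upFrom a (suc k)) y + 1                   ≡⟨ cong (_+ 1) (act-++ (upFrom a (suc k)) [ a + k ] x) ⟨
        act (upFrom a (suc k) ∷ʳ (a + k)) x + 1        ∎
        where
        open ≤-Reasoning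
        y = swap (a + k) x
        y≢top : y ≢ suc (a + suc k)
        y≢top eq = x≢top (trans (sym (swap-involutive (a + k) x))
                           (trans (cong (swap (a + k)) eq) (fix-top a k)))

    Up-top : ∀ {a k e w} → Up p q a k e w → act w (suc (a + k)) ≡ a
    Up-top (plain a k)   = upFrom-top a k
    Up-top (front a k _) = trans (cong (swap (suc a)) (upFrom-top a (suc k))) (swap-below ≤-refl)
    Up-top (back a k _)  = back-top a k
    Up-top (both a k)    = trans (cong (swap (suc a))
      (subst (λ b → act (upFrom a (2 + k) ∷ʳ b) (suc (a + (2 + k))) ≡ a) (+-suc a k) (back-top a (suc k))))
      (swap-below ≤-refl)

    -- Away from its top point the run lowers nothing, and each of the `e` extra letters lowers a
    -- point by at most one.
    Up-drop : ∀ {a k e w} → Up p q a k e w → ∀ x → x ≢ suc (a + k) → x ≤ act w x + e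
    Up-drop (plain a k) x x≢top = ≤-trans (proj₁ (upFrom-nondrop a k x x≢top)) (m≤m+n _ 0)
    Up-drop (front a k _) x x≢top =
      ≤-trans (proj₁ (upFrom-nondrop a (suc k) x x≢top))
        (≤-trans (swap-drop (suc a) _) (≤-reflexive (+-comm 1 _)))
    Up-drop (both a k) x x≢top = ≤-trans
      (subst (λ b → x ≤ act (upFrom a (2 + k) ∷ʳ b) x + 1) (+-suc a k) (back-drop a (suc k) x x≢top))
      (≤-trans (+-monoˡ-≤ 1 (swap-drop (suc a) (act (upFrom a (2 + k) ∷ʳ suc (a + k)) x)))
        (≤-reflexive (sym (+-suc _ 1))))
    Up-drop (back a k _) x x≢top = back-drop a k x x≢top

    -- The top of `u` drops by k + 1. Not being the top of `v`, it can drop under `v` only through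
    -- the extra letters, so k + 1 ≤ e′ ≤ k′. Used in both directions, this is contradictory.
    Up-exceeds : ∀ {a k e a′ k′ e′ u v} → Up p q a k e u → Up p q a′ k′ e′ v → u ≐ v →
      suc (a + k) ≢ suc (a′ + k′) → k < k′
    Up-exceeds {a} {k} {e′ = e′} {u} {v} U V u≐v top≢ = ≤-trans (+-cancelˡ-≤ a _ _ (begin
      a + suc k                    ≡⟨ +-suc a k ⟩
      suc (a + k)                  ≤⟨ Up-drop V (suc (a + k)) top≢ ⟩
      act v (suc (a + k)) + e′     ≡⟨ cong (_+ e′) (trans (sym (u≐v _)) (Up-top U)) ⟩
      a + e′                       ∎)) (Up-extra V)
      where open ≤-Reasoning

    -- suc (a + k) is the only point that the word moves down by more than k.
    Up-interval : ∀ {a k e a′ k′ e′ u v} → Up p q a k e u → Up p q a′ k′ e′ v → u ≐ v →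
      a ≡ a′ × k ≡ k′
    Up-interval {a} {k} {e} {a′} {k′} {e′} {u} {v} U V u≐v with suc (a + k) ≟ suc (a′ + k′)
    ... | yes eq = a≡a′ , +-cancelˡ-≡ a k k′ (trans (suc-injective eq) (cong (_+ k′) (sym a≡a′)))
      where
      a≡a′ : a ≡ a′
      a≡a′ = trans (sym (Up-top U)) (trans (u≐v _) (trans (cong (act v) eq) (Up-top V)))
    ... | no neq = contradiction (Up-exceeds U V u≐v neq)
      (<-asym (Up-exceeds V U (λ x → sym (u≐v x)) (≢-sym neq)))

    -- For k = 0 the two words do agree, both being (a a+2), and the bounds by `p` and `q` exclude
    -- one of them. For larger k they differ at the point `a`, sent to a + 2 by the first and to a +
    -- 1 by the second.
    front≠back : 1 ≤ p + q → ∀ a k → p ≤ k → q ≤ k →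
      ¬ (suc a ∷ upFrom a (suc k) ≐ upFrom a (suc k) ∷ʳ (a + k))
    front≠back 1≤p+q a zero p≤k q≤k _ =
      contradiction (≤-trans 1≤p+q (+-mono-≤ p≤k q≤k)) λ()
    front≠back 1≤p+q a (suc k) p≤k q≤k eq =
      contradiction (trans (sym lhs) (trans (eq a) rhs)) 1+n≢n
      where
      lhs : act (suc a ∷ upFrom a (2 + k)) a ≡ suc (suc a)
      lhs = trans (cong (swap (suc a)) (upFrom-bottom a (2 + k))) (swap-left (suc a))
      rhs : act (upFrom a (2 + k) ∷ʳ (a + suc k)) a ≡ suc a
      rhs = trans (act-++ (upFrom a (2 + k)) [ a + suc k ] a)
        (trans (cong (act (upFrom a (2 + k))) (swap-below (m<m+n a z<s))) (upFrom-bottom a (2 + k)))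

    Up-unique′ : 1 ≤ p + q → ∀ {a k e a′ k′ e′ u v} → Up p q a k e u → Up p q a′ k′ e′ v →
      a ≡ a′ → k ≡ k′ → e ≡ e′ → u ≐ v → u ≡ v
    Up-unique′ pq (plain a k)     (plain _ _)      refl refl refl u≐v = refl
    Up-unique′ pq (front a k _)   (front _ _ _)    refl refl refl u≐v = refl
    Up-unique′ pq (front a k p≤k) (back _ _ q≤k)   refl refl refl u≐v =
      ⊥-elim (front≠back pq a k p≤k q≤k u≐v)
    Up-unique′ pq (back a k q≤k)  (front _ _ p≤k)  refl refl refl u≐v =
      ⊥-elim (front≠back pq a k p≤k q≤k (λ x → sym (u≐v x)))
    Up-unique′ pq (back a k _)    (back _ _ _)     refl refl refl u≐v = refl
    Up-unique′ pq (both a k)      (both _ _)       refl refl refl u≐v = refl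

    -- The permutation fixes the interval, the length then fixes the number of extra letters, and
    -- only front against back remains to be told apart.
    Up-unique : 1 ≤ p + q → ∀ {a k e a′ k′ e′ u v} → Up p q a k e u → Up p q a′ k′ e′ v →
      length u ≡ length v → u ≐ v → u ≡ v
    Up-unique pq {e = e} {e′ = e′} {u} {v} U V len u≐v with refl , refl ← Up-interval U V u≐v =
      Up-unique′ pq U V refl refl
        (+-cancelˡ-≡ _ e e′ (trans (sym (Up-length U)) (trans len (Up-length V)))) u≐v

  data Down (p q : ℕ) : List ℕ → Set where
    plain : ∀ a k → Down p q (downTo a k)
    front : ∀ a k → p ≤ k → Down p q ((a + k) ∷ downTo a (suc k))
    back  : ∀ a k → q ≤ k → Down p q (downTo a (suc k) ∷ʳ suc a)
    both  : ∀ a k → Down p q (suc (a + k) ∷ downTo a (2 + k) ∷ʳ suc a)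

  -- Reversal exchanges front and back, hence the two bounds `p` and `q`.
  Down-reverse : ∀ {p q w} → Down p q w → ∃[ a ] ∃[ k ] ∃[ e ] Up q p a k e (reverse w)
  Down-reverse (plain a k) rewrite reverse-downTo a k = _ , _ , _ , plain a k
  Down-reverse (front a k p≤k)
    rewrite unfold-reverse (a + k) (downTo a (suc k)) | reverse-downTo a (suc k) = _ , _ , _ , back a k p≤k
  Down-reverse (back a k q≤k)
    rewrite reverse-++ (downTo a (suc k)) [ suc a ] | reverse-downTo a (suc k) = _ , _ , _ , front a k q≤k
  Down-reverse (both a k)
    rewrite unfold-reverse (suc (a + k)) (downTo a (2 + k) ∷ʳ suc a)
          | reverse-++ (downTo a (2 + k)) [ suc a ] | reverse-downTo a (2 + k) = _ , _ , _ , both a k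

  Down-unique : ∀ {p q u v} → 1 ≤ q + p → Down p q u → Down p q v →
    length u ≡ length v → u ≐ v → u ≡ v
  Down-unique {u = u} {v} qp D E len u≐v
    with _ , _ , _ , U ← Down-reverse D | _ , _ , _ , V ← Down-reverse E =
    reverse-injective (Up-unique qp U V
      (trans (length-reverse u) (trans len (sym (length-reverse v)))) (≐-reverse u v u≐v))

-- Classification of the walks that contain neither a zigzag nor a turn.

module Zigzags where

  open AdjacentTranspositions
  open import Data.List.Relation.Unary.Linked as Linked using (Linked; _∷_)
  open import Data.Nat using (_+_; _≤_; z≤n; s≤s)

  Step : ℕ → ℕ → Set
  Step a b = b ≡ suc a ⊎ a ≡ suc b

  NoZigzag : {A : Set} → List A → Set
  NoZigzag w = ∀ x a b y → w ≢ x ++ a ∷ b ∷ a ∷ b ∷ y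

  -- The letters `a` and `c` may coincide here; that case contains a zigzag, which is how
  -- `walk-shape` treats it.
  NoTurn : {A : Set} → List A → Set
  NoTurn w = ∀ x a b c y → w ≢ x ++ a ∷ b ∷ c ∷ b ∷ a ∷ y

  -- With bounds 0 and 1 the two words of (a a+2) fall on opposite sides: a+1, a, a+1 is `up` and a,
  -- a+1, a is `down`.
  data Shape : List ℕ → Set where
    empty : Shape []
    up    : ∀ {a k e w} → Up 0 1 a k e w → Shape w
    down  : ∀ {w} → Down 0 1 w → Shape w

  upFrom-head : ∀ a k → ∃[ t ] upFrom a k ≡ a ∷ t
  upFrom-head a zero    = _ , refl
  upFrom-head a (suc k) = _ , refl

  downTo-head : ∀ a k → ∃[ t ] downTo a k ≡ (a + k) ∷ t
  downTo-head a zero    = _ , cong [_] (sym (+-identityʳ a))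
  downTo-head a (suc k) = _ , cong (_∷ downTo a k) (sym (+-suc a k))

  -- A new first letter lengthens the run or becomes its extra front letter. If there is a front
  -- letter already, a zigzag or a turn appears, except in short words, which can still change
  -- direction.
  extend-up : ∀ c {a k e w} → Up 0 1 a k e w → Linked Step (c ∷ w) →
    NoZigzag (c ∷ w) → NoTurn (c ∷ w) → Shape (c ∷ w)
  extend-up c (plain a zero) (inj₁ refl ∷ _) noZ noT = up (plain c 1)
  extend-up c (plain a zero) (inj₂ refl ∷ _) noZ noT =
    down (subst (λ b → Down 0 1 (suc b ∷ a ∷ [])) (+-identityʳ a) (plain a 1))
  extend-up c (plain a (suc k)) (inj₁ refl ∷ _) noZ noT = up (plain c (2 + k))
  extend-up c (plain a (suc k)) (inj₂ refl ∷ _) noZ noT = up (front a k z≤n)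
  extend-up c (front a k _) (inj₁ refl ∷ _) noZ noT with t , eq ← upFrom-head (suc a) k =
    ⊥-elim (noZ [] a (suc a) t (cong (λ v → a ∷ suc a ∷ a ∷ v) eq))
  -- The word a+2, a+1, a, a+1 is a descending run with an extra last letter.
  extend-up c (front a zero _) (inj₂ refl ∷ _) noZ noT =
    down (subst (λ v → Down 0 1 (v ∷ʳ suc a)) eq (back a 1 (s≤s z≤n)))
    where
    eq : downTo a 2 ≡ suc (suc a) ∷ suc a ∷ a ∷ []
    eq = cong₂ (λ b b′ → suc b ∷ suc b′ ∷ a ∷ []) (+-comm a 1) (+-identityʳ a)
  extend-up c (front a (suc k) _) (inj₂ refl ∷ _) noZ noT with t , eq ← upFrom-head (suc (suc a)) k =
    ⊥-elim (noT [] (suc (suc a)) (suc a) a t (cong (λ v → suc (suc a) ∷ suc a ∷ a ∷ suc a ∷ v) eq))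
  extend-up c (back a (suc k) _) (inj₁ refl ∷ _) noZ noT =
    up (subst (λ b → Up 0 1 c (3 + k) 1 (upFrom c (3 + k) ∷ʳ b)) (+-suc c (suc k))
         (back c (2 + k) (s≤s z≤n)))
  extend-up c (back a (suc k) _) (inj₂ refl ∷ _) noZ noT =
    up (subst (λ b → Up 0 1 a (2 + k) 2 (suc a ∷ upFrom a (2 + k) ∷ʳ b)) (sym (+-suc a k)) (both a k))
  extend-up c (both a k) (inj₁ refl ∷ _) noZ noT = ⊥-elim (noZ [] a (suc a) _ refl)
  extend-up c (both a k) (inj₂ refl ∷ _) noZ noT with t , eq ← upFrom-head (suc (suc a)) k =
    ⊥-elim (noT [] (suc (suc a)) (suc a) a (t ∷ʳ suc (a + k))
      (cong (λ v → suc (suc a) ∷ suc a ∷ a ∷ suc a ∷ v ∷ʳ suc (a + k)) eq))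

  extend-down : ∀ c {w} → Down 0 1 w → Linked Step (c ∷ w) →
    NoZigzag (c ∷ w) → NoTurn (c ∷ w) → Shape (c ∷ w)
  extend-down c (plain a zero) (inj₁ refl ∷ _) noZ noT = up (plain c 1)
  extend-down c (plain a zero) (inj₂ refl ∷ _) noZ noT =
    down (subst (λ b → Down 0 1 (suc b ∷ a ∷ [])) (+-identityʳ a) (plain a 1))
  extend-down c (plain a (suc k)) (inj₁ refl ∷ _) noZ noT = down (front a k z≤n)
  extend-down c (plain a (suc k)) (inj₂ refl ∷ _) noZ noT =
    down (subst (λ b → Down 0 1 (suc b ∷ downTo a (suc k))) (+-suc a k) (plain a (2 + k)))
  extend-down c (front a k _) (inj₂ refl ∷ _) noZ noT with t , eq ← downTo-head a k =
    ⊥-elim (noZ [] (suc (a + k)) (a + k) t (cong (λ v → suc (a + k) ∷ a + k ∷ suc (a + k) ∷ v) eq))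
  -- The mirror case: c, c+1, c+2, c+1 is an ascending run with an extra last letter.
  extend-down c (front a zero _) (inj₁ a+0≡1+c ∷ _) noZ noT
    rewrite +-identityʳ a | a+0≡1+c =
    up (subst (λ b → Up 0 1 c 2 1 (upFrom c 2 ∷ʳ b)) (+-comm c 1) (back c 1 (s≤s z≤n)))
  extend-down c (front a (suc k) _) (inj₁ eq ∷ _) noZ noT
    with t , eq′ ← downTo-head a k | refl ← suc-injective (trans (sym (+-suc a k)) eq) =
    ⊥-elim (noT [] (a + k) (a + suc k) (suc (a + suc k)) t
      (cong₂ (λ b v → (a + k) ∷ (a + suc k) ∷ suc (a + suc k) ∷ b ∷ v) (sym (+-suc a k)) eq′))
  extend-down c (back a k 1≤k) (inj₂ refl ∷ _) noZ noT =
    down (subst (λ b → Down 0 1 (suc b ∷ downTo a (suc k) ∷ʳ suc a)) (+-suc a k)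
      (back a (suc k) (s≤s z≤n)))
  extend-down c (back a (suc k) 1≤k) (inj₁ eq ∷ _) noZ noT with refl ← suc-injective eq =
    down (subst (λ b → Down 0 1 (b ∷ downTo a (2 + k) ∷ʳ suc a)) (sym (+-suc a k)) (both a k))
  extend-down c (both a k) (inj₂ refl ∷ _) noZ noT =
    ⊥-elim (noZ [] (suc (suc (a + k))) (suc (a + k)) _
      (cong (λ b → suc (suc (a + k)) ∷ suc (a + k) ∷ suc b ∷ suc (a + k) ∷ downTo a k ∷ʳ suc a) (+-suc a k)))
  extend-down c (both a k) (inj₁ refl ∷ _) noZ noT with t , eq ← downTo-head a k =
    ⊥-elim (noT [] (a + k) (suc (a + k)) (suc (a + suc k)) (t ∷ʳ suc a)
      (cong (λ v → (a + k) ∷ suc (a + k) ∷ suc (a + suc k) ∷ suc (a + k) ∷ v ∷ʳ suc a) eq))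

  shape : ∀ w → Linked Step w → NoZigzag w → NoTurn w → Shape w
  shape []      _ _ _ = empty
  shape (c ∷ w) l noZ noT
    with shape w (Linked.tail l) (λ x a b y eq → noZ (c ∷ x) a b y (cong (c ∷_) eq))
           (λ x a b d y eq → noT (c ∷ x) a b d y (cong (c ∷_) eq))
  ... | empty  = up (plain c 0)
  ... | up U   = extend-up c U l noZ noT
  ... | down D = extend-down c D l noZ noT

  -- The empty word shares a value with the ascending words without conflict: those are nonempty,
  -- and reduced words of one permutation have equal length.
  side : ∀ {w} → Shape w → Fin 2
  side empty    = zero
  side (up _)   = zero
  side (down _) = suc zero

-- Words and the permutations that they represent.

module ReducedWords where

  open AdjacentTranspositions
  open import Data.Fin.Induction using (<-weakInduction)
  import Data.Fin.Permutation.Components as PC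
  open import Data.Fin.Permutation.Transposition.List using (TranspositionList; eval; decompose; eval-decompose)
  open import Data.Fin.Properties using (toℕ-inject₁; toℕ-fromℕ<; toℕ<n)
  open import Data.List.Membership.Propositional using (_∈_; find; lose)
  open import Data.List.Membership.Propositional.Properties
    using (∈-cartesianProductWith⁺; ∈-cartesianProductWith⁻; ∈-allFin)
  open import Data.List.Relation.Unary.Any using (here; there; any?)
  open import Data.Nat using (_≤_; _<_)
  open import Data.Nat.Induction using (<-rec)
  import Relation.Binary.Construct.On as On
  open import Relation.Binary.Structures using (IsEquivalence)

  infix 4 _≗_
  -- The comparison runs over all of ℕ, where the results on runs are stated; `≗⇒≈` and `≈⇒≗`
  -- translate to equality of permutations.
  _≗_ : ∀ {n} → Word n → Word n → Set
  u ≗ v = map toℕ u ≐ map toℕ v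

  toℕ-s : ∀ {n} (i : Fin n) (x : Fin (suc n)) → toℕ (s i ⟨$⟩ʳ x) ≡ swap (toℕ i) (toℕ x)
  toℕ-s i x with x Fin.≟ inject₁ i
  ... | yes refl rewrite toℕ-inject₁ i = sym (swap-left (toℕ i))
  ... | no x≢i with x Fin.≟ suc i
  ...   | yes refl = trans (toℕ-inject₁ i) (sym (swap-right (toℕ i)))
  ...   | no x≢1+i = sym (swap-fix (toℕ i) (toℕ x)
            (λ eq → x≢i (toℕ-injective (trans eq (sym (toℕ-inject₁ i)))))
            (λ eq → x≢1+i (toℕ-injective eq)))

  toℕ-⟦⟧ : ∀ {n} (w : Word n) (x : Fin (suc n)) → toℕ (⟦ w ⟧ ⟨$⟩ʳ x) ≡ act (map toℕ w) (toℕ x)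
  toℕ-⟦⟧ []      x = refl
  toℕ-⟦⟧ (i ∷ w) x = trans (toℕ-s i (⟦ w ⟧ ⟨$⟩ʳ x)) (cong (swap (toℕ i)) (toℕ-⟦⟧ w x))

  act-outside : ∀ {n} (w : Word n) {x} → n < x → act (map toℕ w) x ≡ x
  act-outside []      n<x = refl
  act-outside (i ∷ w) n<x =
    trans (cong (swap (toℕ i)) (act-outside w n<x)) (swap-above (≤-<-trans (toℕ<n i) n<x))

  ≗⇒≈ : ∀ {n} (u v : Word n) → u ≗ v → ⟦ u ⟧ ≈ ⟦ v ⟧
  ≗⇒≈ u v u≗v x = toℕ-injective (trans (toℕ-⟦⟧ u x) (trans (u≗v (toℕ x)) (sym (toℕ-⟦⟧ v x))))

  ≈⇒≗ : ∀ {n} (u v : Word n) → ⟦ u ⟧ ≈ ⟦ v ⟧ → u ≗ v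
  ≈⇒≗ {n} u v u≈v x with x <? suc n
  ... | yes x<1+n = begin
    act (map toℕ u) x             ≡⟨ cong (act (map toℕ u)) (sym eq) ⟩
    act (map toℕ u) (toℕ y)       ≡⟨ toℕ-⟦⟧ u y ⟨
    toℕ (⟦ u ⟧ ⟨$⟩ʳ y)            ≡⟨ cong toℕ (u≈v y) ⟩
    toℕ (⟦ v ⟧ ⟨$⟩ʳ y)            ≡⟨ toℕ-⟦⟧ v y ⟩
    act (map toℕ v) (toℕ y)       ≡⟨ cong (act (map toℕ v)) eq ⟩
    act (map toℕ v) x             ∎
    where
    open ≡-Reasoning
    y  = fromℕ< x<1+n
    eq = toℕ-fromℕ< x<1+n
  -- Beyond n every word acts as the identity.
  ... | no x≮1+n = trans (act-outside u n<x) (sym (act-outside v n<x))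
    where n<x = ≮⇒≥ x≮1+n

  ≗-context : ∀ {n} (x : Word n) {u v : Word n} (y : Word n) → u ≗ v → x ++ u ++ y ≗ x ++ v ++ y
  ≗-context x {u} {v} y u≗v p = begin
    act (map toℕ (x ++ u ++ y)) p                          ≡⟨ split u ⟩
    act (map toℕ x) (act (map toℕ u) (act (map toℕ y) p))  ≡⟨ cong (act (map toℕ x)) (u≗v _) ⟩
    act (map toℕ x) (act (map toℕ v) (act (map toℕ y) p))  ≡⟨ split v ⟨
    act (map toℕ (x ++ v ++ y)) p                          ∎
    where
    open ≡-Reasoning
    split : ∀ w → act (map toℕ (x ++ w ++ y)) p ≡ act (map toℕ x) (act (map toℕ w) (act (map toℕ y) p))
    split w = begin
      act (map toℕ (x ++ w ++ y)) p                         ≡⟨ cong (λ z → act z p) (map-++ toℕ x (w ++ y)) ⟩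
      act (map toℕ x ++ map toℕ (w ++ y)) p                 ≡⟨ act-++ (map toℕ x) _ p ⟩
      act (map toℕ x) (act (map toℕ (w ++ y)) p)            ≡⟨ cong (λ z → act (map toℕ x) (act z p)) (map-++ toℕ w y) ⟩
      act (map toℕ x) (act (map toℕ w ++ map toℕ y) p)      ≡⟨ cong (act (map toℕ x)) (act-++ (map toℕ w) (map toℕ y) p) ⟩
      act (map toℕ x) (act (map toℕ w) (act (map toℕ y) p)) ∎

  -- Generation of the symmetric group by adjacent transpositions.

  ⟦⟧-++ : ∀ {n} (u v : Word n) x → ⟦ u ++ v ⟧ ⟨$⟩ʳ x ≡ ⟦ u ⟧ ⟨$⟩ʳ (⟦ v ⟧ ⟨$⟩ʳ x)
  ⟦⟧-++ []      v x = refl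
  ⟦⟧-++ (i ∷ u) v x = cong (s i ⟨$⟩ʳ_) (⟦⟧-++ u v x)

  Generated : ∀ {n} → (Fin (suc n) → Fin (suc n)) → Set
  Generated {n} f = ∃[ w ] ∀ x → f x ≡ ⟦_⟧ {n} w ⟨$⟩ʳ x

  transpose-left : ∀ {n} (i j : Fin n) → PC.transpose i j i ≡ j
  transpose-left i j with i Fin.≟ i
  ... | yes _  = refl
  ... | no i≢i = contradiction refl i≢i

  transpose-right : ∀ {n} (i j : Fin n) → PC.transpose i j j ≡ i
  transpose-right i j with j Fin.≟ i
  ... | yes j≡i = j≡i
  ... | no _ with j Fin.≟ j
  ...   | yes _  = refl
  ...   | no j≢j = contradiction refl j≢j

  transpose-fix : ∀ {n} (i j x : Fin n) → x ≢ i → x ≢ j → PC.transpose i j x ≡ x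
  transpose-fix i j x x≢i x≢j with x Fin.≟ i
  ... | yes x≡i = contradiction x≡i x≢i
  ... | no _ with x Fin.≟ j
  ...   | yes x≡j = contradiction x≡j x≢j
  ...   | no _    = refl

  transpose-unique : ∀ {n} (i j : Fin n) (f : Fin n → Fin n) →
    f i ≡ j → f j ≡ i → (∀ x → x ≢ i → x ≢ j → f x ≡ x) → ∀ x → PC.transpose i j x ≡ f x
  transpose-unique i j f fi fj fix x with x Fin.≟ i
  ... | yes refl = sym fi
  ... | no x≢i with x Fin.≟ j
  ...   | yes refl = sym fj
  ...   | no x≢j   = sym (fix x x≢i x≢j)

  Generated-sym : ∀ {n} (i j : Fin (suc n)) → Generated (PC.transpose i j) → Generated (PC.transpose j i)
  Generated-sym i j (w , eq) = w , λ x → trans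
    (transpose-unique j i (PC.transpose i j) (transpose-right i j) (transpose-left i j)
      (λ x x≢j x≢i → transpose-fix i j x x≢i x≢j) x)
    (eq x)

  inject₁≢suc : ∀ {n} (m : Fin n) → inject₁ m ≢ suc m
  inject₁≢suc m eq = 1+n≢n (sym (trans (sym (toℕ-inject₁ m)) (cong toℕ eq)))

  -- (i  m+1) is the conjugate of (i  m) by s m unless i is m or m+1.
  Generated-suc : ∀ {n} (i : Fin (suc n)) (m : Fin n) →
    Generated (PC.transpose i (inject₁ m)) → Generated (PC.transpose i (suc m))
  Generated-suc i m (w , eq) with i Fin.≟ inject₁ m | i Fin.≟ suc m
  ... | yes refl | _ = [ m ] , λ x → refl
  ... | no _ | yes refl = [] , transpose-unique (suc m) (suc m) (λ x → x) refl refl (λ _ _ _ → refl)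
  ... | no i≢m | no i≢1+m = m ∷ w ++ [ m ] , λ x → trans
    (transpose-unique i (suc m) conj at-i at-1+m elsewhere x)
    (cong (s m ⟨$⟩ʳ_) (trans (eq _) (sym (⟦⟧-++ w [ m ] x))))
    where
    conj = λ x → s m ⟨$⟩ʳ (PC.transpose i (inject₁ m) (s m ⟨$⟩ʳ x))
    at-i : conj i ≡ suc m
    at-i = trans (cong (λ y → s m ⟨$⟩ʳ (PC.transpose i (inject₁ m) y)) (transpose-fix _ _ i i≢m i≢1+m))
      (trans (cong (s m ⟨$⟩ʳ_) (transpose-left i (inject₁ m))) (transpose-left (inject₁ m) (suc m)))
    at-1+m : conj (suc m) ≡ i
    at-1+m = trans (cong (λ y → s m ⟨$⟩ʳ (PC.transpose i (inject₁ m) y)) (transpose-right (inject₁ m) (suc m)))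
      (trans (cong (s m ⟨$⟩ʳ_) (transpose-right i (inject₁ m))) (transpose-fix _ _ i i≢m i≢1+m))
    elsewhere : ∀ x → x ≢ i → x ≢ suc m → conj x ≡ x
    elsewhere x x≢i x≢1+m = split (x Fin.≟ inject₁ m)
      where
      split : Dec (x ≡ inject₁ m) → conj x ≡ x
      split (yes refl) = trans
        (cong (λ y → s m ⟨$⟩ʳ (PC.transpose i (inject₁ m) y)) (transpose-left (inject₁ m) (suc m)))
        (trans (cong (s m ⟨$⟩ʳ_) (transpose-fix i (inject₁ m) (suc m) (≢-sym i≢1+m) (≢-sym (inject₁≢suc m))))
          (transpose-right (inject₁ m) (suc m)))
      split (no x≢m) = trans
        (cong (λ y → s m ⟨$⟩ʳ (PC.transpose i (inject₁ m) y)) (transpose-fix _ _ x x≢m x≢1+m))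
        (trans (cong (s m ⟨$⟩ʳ_) (transpose-fix i (inject₁ m) x x≢i x≢m)) (transpose-fix _ _ x x≢m x≢1+m))

  -- `Generated-suc` moves the second endpoint only. The inner induction leads from (0 0) to (0 i),
  -- symmetry turns this into (i 0), and the outer induction leads on to (i j).
  transposition-generated : ∀ {n} (i j : Fin (suc n)) → Generated (PC.transpose i j)
  transposition-generated i j = <-weakInduction (λ j → Generated (PC.transpose i j))
    (Generated-sym zero i (<-weakInduction (λ j → Generated (PC.transpose zero j))
      ([] , transpose-unique zero zero (λ x → x) refl refl (λ _ _ _ → refl))
      (Generated-suc zero) i))
    (Generated-suc i) j

  eval-word : ∀ {n} (ts : TranspositionList (suc n)) → ∃[ w ] eval ts ≈ ⟦_⟧ {n} w
  eval-word [] = [] , λ x → refl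
  eval-word ((i , j) ∷ ts)
    with u , u-eq ← eval-word ts | v , v-eq ← transposition-generated i j =
    -- `eval` applies its head transposition first, and the rightmost letters of a word act first,
    -- so `v` stands on the right.
    u ++ v , λ x → trans (u-eq _) (trans (cong (⟦ u ⟧ ⟨$⟩ʳ_) (v-eq x)) (sym (⟦⟧-++ u v x)))

  word : ∀ {n} (σ : Permutation′ (suc n)) → ∃[ w ] σ ≈ ⟦_⟧ {n} w
  word σ with w , eq ← eval-word (decompose σ) = w , λ x → trans (sym (eval-decompose σ x)) (eq x)

  -- Existence, decidability and enumeration of reduced words.

  words : ∀ n → ℕ → List (Word n)
  words n zero    = [ [] ]
  words n (suc l) = cartesianProductWith _∷_ (allFin n) (words n l)

  ∈-words : ∀ {n} (w : Word n) → w ∈ words n (length w)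
  ∈-words []      = here refl
  ∈-words (i ∷ w) = ∈-cartesianProductWith⁺ _∷_ (∈-allFin i) (∈-words w)

  length-words : ∀ {n} l {w : Word n} → w ∈ words n l → length w ≡ l
  length-words zero    (here refl) = refl
  length-words {n} (suc l) w∈
    with _ , _ , _ , v∈ , refl ← ∈-cartesianProductWith⁻ _∷_ (allFin n) (words n l) w∈ =
    cong suc (length-words l v∈)

  module _ {n} (σ : Permutation′ (suc n)) where

    represents? : (w : Word n) → Dec (σ ≈ ⟦ w ⟧)
    represents? w = Fin.all? (λ x → (σ ⟨$⟩ʳ x) Fin.≟ (⟦ w ⟧ ⟨$⟩ʳ x))

    private
      -- Descent on length: the finitely many words of each smaller length are searched, and when
      -- none represents `σ` the current word is reduced.
      reduce : ∀ l (w : Word n) → length w ≡ l → σ ≈ ⟦ w ⟧ → ∃[ v ] IsReducedWord σ v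
      reduce = <-rec _ λ l rec w |w|≡l σ≈w →
        case anyUpTo? (λ l → any? represents? (words n l)) l of λ
          { (yes (l′ , l′<l , found)) → let v , v∈ , σ≈v = find found in
              rec l′<l v (length-words l′ v∈) σ≈v
          ; (no minimal) → w , σ≈w , λ v σ≈v → subst (_≤ length v) (sym |w|≡l)
              (≮⇒≥ λ |v|<l → minimal (length v , |v|<l , lose (∈-words v) σ≈v))
          }

    reducedWord : ∃[ w ] IsReducedWord σ w
    reducedWord = let w , σ≈w = word σ in reduce (length w) w refl σ≈w

    private
      shortest = proj₁ reducedWord

    -- Minimality quantifies over all words, but comparison with the length of one known reduced
    -- word decides it.
    isReducedWord? : (w : Word n) → Dec (IsReducedWord σ w)
    isReducedWord? w = map′
      (λ (σ≈w , |w|≤) → σ≈w , λ v σ≈v → ≤-trans |w|≤ (proj₂ (proj₂ reducedWord) v σ≈v))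
      (λ (σ≈w , min) → σ≈w , min shortest (proj₁ (proj₂ reducedWord)))
      (represents? w ×-dec (length w ≤? length shortest))

    -- All words of the minimal length, whether or not they represent `σ`; `transversal` discards
    -- the others by its decision procedure.
    reducedWords : List (Word n)
    reducedWords = words n (length shortest)

    ∈-reducedWords : ∀ {w} → IsReducedWord σ w → w ∈ reducedWords
    ∈-reducedWords {w} (σ≈w , min) = subst (λ l → w ∈ words n l)
      (≤-antisym (min shortest (proj₁ (proj₂ reducedWord))) (proj₂ (proj₂ reducedWord) w σ≈w))
      (∈-words w)

  -- Cardinality of a finite set modulo a decidable equivalence.

  module _ {A : Set} {P : A → Set} (P? : ∀ a → Dec (P a)) {_~_ : A → A → Set}
    (eqv : IsEquivalence _~_) (_~?_ : ∀ a b → Dec (a ~ b)) where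

    private
      module ~ = IsEquivalence eqv

    Transversal : List A → Set
    Transversal as = ∃[ k ] Σ (Fin k → Σ A P) λ f →
      (∀ i j → proj₁ (f i) ~ proj₁ (f j) → i ≡ j) ×
      (∀ {a} → a ∈ as → P a → ∃[ i ] a ~ proj₁ (f i))

    -- Greedy choice: an element satisfying `P` is added only if it is equivalent to no
    -- representative chosen so far.
    transversal : ∀ as → Transversal as
    transversal [] = 0 , (λ ()) , (λ ()) , λ ()
    transversal (a ∷ as) with transversal as | P? a
    ... | k , f , inj , cover | no ¬Pa = k , f , inj ,
      λ { (here refl) Pa → contradiction Pa ¬Pa ; (there a∈) Pa → cover a∈ Pa }
    ... | k , f , inj , cover | yes Pa with Fin.any? (λ i → a ~? proj₁ (f i))
    ...   | yes old = k , f , inj , λ { (here refl) _ → old ; (there a∈) → cover a∈ }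
    ...   | no new = suc k , g , g-inj ,
      λ { (here refl) _ → zero , ~.refl ; (there a∈) Pa → map-suc (cover a∈ Pa) }
      where
      g : Fin (suc k) → Σ A P
      g zero    = a , Pa
      g (suc i) = f i
      g-inj : ∀ i j → proj₁ (g i) ~ proj₁ (g j) → i ≡ j
      g-inj zero    zero    eq = refl
      g-inj zero    (suc j) eq = contradiction (j , eq) new
      g-inj (suc i) zero    eq = contradiction (i , ~.sym eq) new
      g-inj (suc i) (suc j) eq = cong suc (inj i j eq)
      map-suc : ∀ {b} → (∃[ i ] b ~ proj₁ (f i)) → ∃[ i ] b ~ proj₁ (g i)
      map-suc (i , eq) = suc i , eq

    -- The bijection sends an element to the index of its representative. With equality this counts
    -- reduced words, with `_~_` commutation classes.
    finite : ∀ as → (∀ {a} → P a → a ∈ as) →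
      ∃[ k ] HasCardinality (On.setoid {B = Σ A P} (record { isEquivalence = eqv }) proj₁) k
    finite as all with k , f , inj , cover ← transversal as = k , record
      { to        = index
      ; cong      = λ {x} {y} x~y → inj _ _ (~.trans (~.sym (index-~ x)) (~.trans x~y (index-~ y)))
      ; bijective =
          (λ {x} {y} eq → ~.trans (index-~ x) (subst (λ i → proj₁ (f i) ~ proj₁ y) (sym eq) (~.sym (index-~ y))))
        , (λ i → f i , λ {z} z~fi → inj _ _ (~.trans (~.sym (index-~ z)) z~fi))
      }
      where
      index   = λ (x : Σ A P) → proj₁ (cover (all (proj₂ x)) (proj₂ x))
      index-~ = λ (x : Σ A P) → proj₂ (cover (all (proj₂ x)) (proj₂ x))

-- Commutation equivalence and its decision by projections.

module CommutationClasses where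

  open import Data.List.Relation.Unary.Linked as Linked using (Linked; []; [-]; _∷_)
  open import Data.Nat using (_>_; ∣_-_∣)
  open import Relation.Binary.Construct.Closure.ReflexiveTransitive using (ε; _◅_; _◅◅_)
  open import Relation.Binary.Construct.Closure.Symmetric using (fwd)
  import Relation.Binary.Construct.On as On

  linked-at : ∀ {A : Set} {R : A → A → Set} x {a b y} → Linked R (x ++ a ∷ b ∷ y) → R a b
  linked-at []      l = Linked.head l
  linked-at (_ ∷ x) l = linked-at x (Linked.tail l)

  module _ {n : ℕ} where

    -- A record type determines `i` and `j`, which the bare inequality does not, so they can be
    -- inferred.
    record Far (i j : Fin n) : Set where
      constructor far
      field
        apart : ∣ toℕ i - toℕ j ∣ > 1

    open Far

    data Kept (i j : Fin n) : Fin n → Set where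
      keptˡ  : Kept i j i
      keptʳ : Kept i j j

    far? : ∀ i j → Dec (Far i j)
    far? i j = map′ far apart (1 <? ∣ toℕ i - toℕ j ∣)

    Far-sym : ∀ {i j} → Far i j → Far j i
    Far-sym {i} {j} (far i#j) = far (subst (_> 1) (∣-∣-comm (toℕ i) (toℕ j)) i#j)

    Far-irrefl : ∀ {i} → ¬ Far i i
    Far-irrefl {i} (far i#i) = contradiction (subst (_> 1) (∣n-n∣≡0 (toℕ i)) i#i) λ()

    Far⇒≢ : ∀ {i j} → Far i j → i ≢ j
    Far⇒≢ f refl = Far-irrefl f

    infix 4 _~_
    _~_ : Word n → Word n → Set
    _~_ = EqClosure Commutation

    ~-sym : ∀ {u v} → u ~ v → v ~ u
    ~-sym = EqC.symmetric Commutation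

    ~-swap : ∀ x {a b} y → Far a b → x ++ a ∷ b ∷ y ~ x ++ b ∷ a ∷ y
    ~-swap x y f = fwd (commute x y (apart f)) ◅ ε

    ~-∷ : ∀ i {u v} → u ~ v → i ∷ u ~ i ∷ v
    ~-∷ i = EqC.gmap (i ∷_) λ { (commute u v f) → commute (i ∷ u) v f }

    keep? : ∀ i j k → Dec (Kept i j k)
    keep? i j k with k Fin.≟ i | k Fin.≟ j
    ... | yes refl | _        = yes keptˡ
    ... | no _     | yes refl = yes keptʳ
    ... | no k≢i   | no k≢j   = no λ { keptˡ → k≢i refl ; keptʳ → k≢j refl }

    -- For equal `i` and `j` the projection records how often that letter occurs.
    project : Fin n → Fin n → Word n → Word n
    project i j = filter (keep? i j)

    project-keep : ∀ i j {k w} → Kept i j k → project i j (k ∷ w) ≡ k ∷ project i j w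
    project-keep i j = filter-accept (keep? i j)

    project-drop : ∀ i j {k w} → ¬ Kept i j k → project i j (k ∷ w) ≡ project i j w
    project-drop i j = filter-reject (keep? i j)

    -- Of two commuting letters at most one is kept: they are distinct, and together they would be
    -- the noncommuting `i` and `j`.
    project-swap : ∀ {i j a b} → ¬ Far i j → Far a b → ∀ w →
      project i j (a ∷ b ∷ w) ≡ project i j (b ∷ a ∷ w)
    project-swap {i} {j} {a} {b} near f w = go (keep? i j a) (keep? i j b)
      where
      go : Dec (Kept i j a) → Dec (Kept i j b) → project i j (a ∷ b ∷ w) ≡ project i j (b ∷ a ∷ w)
      go (no ¬a) (no ¬b) = trans (trans (project-drop i j ¬a) (project-drop i j ¬b))
                            (sym (trans (project-drop i j ¬b) (project-drop i j ¬a)))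
      go (no ¬a) (yes b∈) = trans (trans (project-drop i j ¬a) (project-keep i j b∈))
                            (sym (trans (project-keep i j b∈) (cong (b ∷_) (project-drop i j ¬a))))
      go (yes a∈) (no ¬b) = trans (trans (project-keep i j a∈) (cong (a ∷_) (project-drop i j ¬b)))
                            (sym (trans (project-drop i j ¬b) (project-keep i j a∈)))
      go (yes keptˡ) (yes keptˡ) = contradiction f Far-irrefl
      go (yes keptˡ) (yes keptʳ) = contradiction f near
      go (yes keptʳ) (yes keptˡ) = contradiction (Far-sym f) near
      go (yes keptʳ) (yes keptʳ) = contradiction f Far-irrefl

    ~⇒project : ∀ {u v} → u ~ v → ∀ i j → ¬ Far i j → project i j u ≡ project i j v
    ~⇒project u~v i j near = EqC.fold (On.isEquivalence (project i j) isEquivalence)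
      (λ { (commute x {a} {b} y f) → trans (filter-++ (keep? i j) x _)
        (trans (cong (project i j x ++_) (project-swap near (far {a} {b} f) y)) (sym (filter-++ (keep? i j) x _))) })
      u~v

    -- The hypothesis says that no letter blocking `i` precedes its first occurrence, which can
    -- therefore be commuted to the front.
    pull : ∀ i v → (∀ k → ¬ Far i k → ∃[ t ] project i k v ≡ i ∷ t) → ∃[ v′ ] v ~ i ∷ v′
    pull i [] heads = case proj₂ (heads i Far-irrefl) of λ ()
    pull i (j ∷ v) heads = go (j Fin.≟ i) (far? i j)
      where
      go : Dec (j ≡ i) → Dec (Far i j) → ∃[ v′ ] j ∷ v ~ i ∷ v′
      go (yes refl) _ = v , ε
      go (no j≢i) (no near) = contradiction
        (∷-injectiveˡ (trans (sym (project-keep i j keptʳ)) (proj₂ (heads j near)))) j≢i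
      go (no j≢i) (yes f) = let v′ , v~ = pull i v heads′ in
        j ∷ v′ , ~-∷ j v~ ◅◅ ~-swap [] v′ (Far-sym f)
        where
        heads′ : ∀ k → ¬ Far i k → ∃[ t ] project i k v ≡ i ∷ t
        heads′ k near = map₂ (trans (sym (project-drop i k {j} {v}
          λ { keptˡ → j≢i refl ; keptʳ → near f }))) (heads k near)

    -- The head of `u` is pulled to the front of `v` and then cancelled from every projection.
    project⇒~ : ∀ u v → (∀ i j → ¬ Far i j → project i j u ≡ project i j v) → u ~ v
    project⇒~ []      []      eq = ε
    project⇒~ []      (j ∷ v) eq =
      case trans (eq j j Far-irrefl) (project-keep j j keptˡ) of λ ()
    project⇒~ (i ∷ u) v eq =
      let v′ , v~ = pull i v λ k near → project i k u ,
                      trans (sym (eq i k near)) (project-keep i k keptˡ)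
      in ~-∷ i (project⇒~ u v′ λ a b near → cancel a b
           (trans (eq a b near) (~⇒project v~ a b near))) ◅◅ ~-sym v~
      where
      cancel : ∀ a b {v′} → project a b (i ∷ u) ≡ project a b (i ∷ v′) → project a b u ≡ project a b v′
      cancel a b {v′} eq = go (keep? a b i)
        where
        go : Dec (Kept a b i) → project a b u ≡ project a b v′
        go (yes i∈) = ∷-injectiveʳ (trans (sym (project-keep a b i∈))
                       (trans eq (project-keep a b i∈)))
        go (no ¬i) = trans (sym (project-drop a b ¬i)) (trans eq (project-drop a b ¬i))

    -- Two words are equivalent exactly when their projections to every pair of
    -- noncommuting letters agree.
    _~?_ : ∀ u v → Dec (u ~ v)
    u ~? v = map′ (project⇒~ u v) ~⇒project
      (Fin.all? λ i → Fin.all? λ j → ¬? (far? i j) →-dec ≡-dec Fin._≟_ (project i j u) (project i j v))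

    -- Walks and the leftmost commuting pair of a word.

    Walk : Word n → Set
    Walk = Linked λ i j → ¬ Far i j

    walk? : ∀ w → Dec (Walk w)
    walk? = Linked.linked? λ i j → ¬? (far? i j)

    far⇒¬Walk : ∀ x {a b} y → Far a b → ¬ Walk (x ++ a ∷ b ∷ y)
    far⇒¬Walk x y f l = linked-at x l f

    FirstFar : (x : Word n) (a c : Fin n) → Set
    FirstFar x a c = Walk (x ++ [ a ]) × Far a c

    FarSplit : Word n → Set
    FarSplit w = ∃[ x ] ∃[ a ] ∃[ c ] ∃[ t ] w ≡ x ++ a ∷ c ∷ t × FirstFar x a c

    firstFar : ∀ w → ¬ Walk w → FarSplit w
    firstFar []      ¬walk = contradiction [] ¬walk
    firstFar (a ∷ w) ¬walk = go a w ¬walk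
      where
      go : ∀ a w → ¬ Walk (a ∷ w) → FarSplit (a ∷ w)
      go a []      ¬walk = contradiction [-] ¬walk
      go a (c ∷ w) ¬walk with far? a c
      ... | yes f = [] , a , c , w , refl , [-] , f
      ... | no near with go c w (λ l → ¬walk (near ∷ l))
      ...   | []    , a′ , c′ , t , refl , l , f = a ∷ [] , a′ , c′ , t , refl , near ∷ l , f
      ...   | _ ∷ x , a′ , c′ , t , refl , l , f = a ∷ c ∷ x , a′ , c′ , t , refl , near ∷ l , f

    -- If one prefix were shorter, its commuting pair would lie inside the walk of the other. Mixed
    -- words are decoded by this fact.
    firstFar-unique : ∀ x x′ {a c t a′ c′ t′} → FirstFar x a c → FirstFar x′ a′ c′ →
      x ++ a ∷ c ∷ t ≡ x′ ++ a′ ∷ c′ ∷ t′ → x ≡ x′ × a ≡ a′ × c ≡ c′ × t ≡ t′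
    firstFar-unique []          []            _ _ eq = refl , ∷-injectiveˡ eq , ∷-injectiveˡ (∷-injectiveʳ eq) , ∷-injectiveʳ (∷-injectiveʳ eq)
    firstFar-unique []          (_ ∷ [])      (_ , f) (l , _) refl = contradiction f (Linked.head l)
    firstFar-unique []          (_ ∷ _ ∷ _)   (_ , f) (l , _) refl = contradiction f (Linked.head l)
    firstFar-unique (_ ∷ [])    []            (l , _) (_ , f) refl = contradiction f (Linked.head l)
    firstFar-unique (_ ∷ _ ∷ _) []            (l , _) (_ , f) refl = contradiction f (Linked.head l)
    firstFar-unique (_ ∷ x)     (_ ∷ x′)      (l , f) (l′ , far′) eq
      with x≡x′ , rest ← firstFar-unique x x′ (Linked.tail l , f) (Linked.tail l′ , far′) (∷-injectiveʳ eq)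
      = cong₂ _∷_ (∷-injectiveˡ eq) x≡x′ , rest

    -- Mixed words, and two tokens for a class that is not a single word.

    data Mixed : Word n → Set where
      mixed : ∀ x a c b y → FirstFar x a c → Mixed (x ++ a ∷ c ∷ b ∷ a ∷ c ∷ y)

    mixed⇒¬Walk : ∀ {w} → Mixed w → ¬ Walk w
    mixed⇒¬Walk (mixed x a c b y (_ , f)) = far⇒¬Walk x _ f

    mixed-tail : ∀ {x a c t} → FirstFar x a c → Mixed (x ++ a ∷ c ∷ t) →
      ∃[ b ] ∃[ y ] t ≡ b ∷ a ∷ c ∷ y
    mixed-tail {x} {a} {c} {t} first M = go M refl
      where
      go : ∀ {w} → Mixed w → w ≡ x ++ a ∷ c ∷ t → ∃[ b ] ∃[ y ] t ≡ b ∷ a ∷ c ∷ y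
      go (mixed x′ a′ c′ b y first′) eq with refl , refl , refl , refl ← firstFar-unique x′ x first′ first eq =
        b , y , refl

    mixed? : ∀ w → Dec (Mixed w)
    mixed? w with walk? w
    ... | yes l = no λ M → mixed⇒¬Walk M l
    ... | no ¬l with firstFar w ¬l
    ...   | x , a , c , [] , refl , first = no λ M → case mixed-tail first M of λ { (_ , _ , ()) }
    ...   | x , a , c , _ ∷ [] , refl , first = no λ M → case mixed-tail first M of λ { (_ , _ , ()) }
    ...   | x , a , c , _ ∷ _ ∷ [] , refl , first = no λ M → case mixed-tail first M of λ { (_ , _ , ()) }
    ...   | x , a , c , b ∷ a′ ∷ c′ ∷ y , refl , first with a′ Fin.≟ a | c′ Fin.≟ c
    ...     | yes refl | yes refl = yes (mixed x a c b y first)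
    ...     | no a′≢a  | _        = no λ M → case mixed-tail first M of λ { (_ , _ , refl) → a′≢a refl }
    ...     | yes _    | no c′≢c  = no λ M → case mixed-tail first M of λ { (_ , _ , refl) → c′≢c refl }

    -- Locates the leftmost commuting pair after `c a` replaces `a c` behind the walk `x`: it is
    -- `c a` itself, unless the last letter of `x` already commutes with `c`.
    walk-snoc : ∀ x c → Walk x → Walk (x ++ [ c ]) ⊎ ∃[ x′ ] ∃[ z ] x ≡ x′ ++ [ z ] × Far z c
    walk-snoc []          c l = inj₁ [-]
    walk-snoc (z ∷ [])    c l with far? z c
    ... | yes f = inj₂ ([] , z , refl , f)
    ... | no near = inj₁ (near ∷ [-])
    walk-snoc (a ∷ b ∷ x) c (near ∷ l) with walk-snoc (b ∷ x) c l
    ... | inj₁ l′                  = inj₁ (near ∷ l′)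
    ... | inj₂ (x′ , z , eq , f) = inj₂ (a ∷ x′ , z , cong (a ∷_) eq , f)

    walk-init : ∀ x {a} → Walk (x ++ [ a ]) → Walk x
    walk-init []          l          = []
    walk-init (_ ∷ [])    l          = [-]
    walk-init (_ ∷ _ ∷ x) (near ∷ l) = near ∷ walk-init (_ ∷ x) l

    record Unmixed (w v : Word n) : Set where
      constructor unmixed
      field
        equivalent : w ~ v
        ¬walk      : ¬ Walk v
        ¬mixed     : ¬ Mixed v

    Pair : Word n → Set
    Pair w = ∃[ p ] ∃[ q ] Unmixed w p × Unmixed w q × p ≢ q

    swapped-≢ : ∀ x {a c : Fin n} {t t′} → Far a c → x ++ a ∷ c ∷ t ≢ x ++ c ∷ a ∷ t′
    swapped-≢ x f eq = Far⇒≢ f (∷-injectiveˡ (++-cancelˡ x _ _ eq))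

    mixed-pair : ∀ {w} → Mixed w → Pair w
    mixed-pair (mixed x a c b y first@(l , f)) =
        x ++ a ∷ c ∷ b ∷ c ∷ a ∷ y
      , x ++ c ∷ a ∷ b ∷ a ∷ c ∷ y
      , unmixed second (far⇒¬Walk x _ f) (λ M → case mixed-tail first M of λ { (_ , _ , refl) → Far-irrefl f })
      , unmixed (~-swap x _ f) (far⇒¬Walk x _ (Far-sym f)) ¬mixed
      , swapped-≢ x f
      where
      second : x ++ a ∷ c ∷ b ∷ a ∷ c ∷ y ~ x ++ a ∷ c ∷ b ∷ c ∷ a ∷ y
      second = subst₂ _~_ (++-assoc x (a ∷ c ∷ b ∷ []) _) (++-assoc x (a ∷ c ∷ b ∷ []) _)
        (~-swap (x ++ a ∷ c ∷ b ∷ []) y f)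
        where open import Relation.Binary.PropositionalEquality using (subst₂)
      ¬mixed : ¬ Mixed (x ++ c ∷ a ∷ b ∷ a ∷ c ∷ y)
      -- Whether the leftmost pair is `c a` or `z c`, mixedness would force `a` and `c` to be equal.
      ¬mixed M with walk-snoc x c (walk-init x l)
      ... | inj₁ l′ = case mixed-tail (l′ , Far-sym f) M of λ { (_ , _ , refl) → Far-irrefl f }
      ... | inj₂ (x′ , z , refl , z-far-c) =
        case mixed-tail (walk-init (x′ ++ [ z ]) l , z-far-c)
               (subst Mixed (++-assoc x′ [ z ] _) M) of λ
          { (_ , _ , refl) → Far-irrefl f }

    -- Exchanging the leftmost commuting pair gives a second word of the class. If either of the two
    -- is mixed, `mixed-pair` supplies both tokens instead.
    pair : ∀ w → ¬ Walk w → Pair w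
    pair w ¬l with firstFar w ¬l
    ... | x , a , c , t , refl , l , f with mixed? (x ++ a ∷ c ∷ t) | mixed? (x ++ c ∷ a ∷ t)
    ...   | yes M | _ = mixed-pair M
    ...   | no ¬M | no ¬M′ = _ , _ , unmixed ε ¬l ¬M
                           , unmixed (~-swap x t f) (far⇒¬Walk x t (Far-sym f)) ¬M′
                           , swapped-≢ x f
    ...   | no _ | yes M′ with p , q , P , Q , p≢q ← mixed-pair M′ = p , q , lift P , lift Q , p≢q
      where
      lift : ∀ {v} → Unmixed (x ++ c ∷ a ∷ t) v → Unmixed (x ++ a ∷ c ∷ t) v
      lift (unmixed eq ¬l ¬M) = unmixed (~-swap x t f ◅◅ eq) ¬l ¬M

-- Comparison of letters in `Fin n` with natural numbers, and turns.

module Counting where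

  open AdjacentTranspositions
  open Zigzags
  open ReducedWords
  open CommutationClasses
  open import Data.Fin.Properties using (*↔×; +↔⊎; injective⇒≤)
  import Data.Integer as ℤ
  import Data.Integer.Properties as ℤ
  open import Data.List.Relation.Unary.Linked as Linked using (Linked; []; [-]; _∷_)
  import Data.List.Relation.Unary.Linked.Properties as Linked
  open import Data.Nat using (_+_; _*_; _≤_; _>_; z≤n; s≤s; ∣_-_∣)
  open import Data.Rational as ℚ using (_/_; ½; 1ℚ)
  import Data.Rational.Properties as ℚ
  open import Data.Rational.Unnormalised as ℚᵘ using (mkℚᵘ; *≤*)
  import Data.Rational.Unnormalised.Properties as ℚᵘ
  open import Data.Sum.Properties using (inj₁-injective; inj₂-injective)
  open import Function using (_on_; Bijection; Inverse; Injection)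
  open import Function.Properties.Inverse using (↔⇒↣; ↔-sym)
  open import Relation.Binary.Construct.Closure.ReflexiveTransitive using (ε; _◅_; _◅◅_)
  open import Relation.Binary.Construct.Closure.Symmetric using (fwd; bwd)

  side-unique : ∀ {u v} (S : Shape u) (T : Shape v) → side S ≡ side T →
    length u ≡ length v → u ≐ v → u ≡ v
  side-unique empty    empty    _ _   _   = refl
  side-unique empty    (up V)   _ len _   = contradiction (trans len (Up-length V)) λ()
  side-unique (up U)   empty    _ len _   = contradiction (trans (sym len) (Up-length U)) λ()
  side-unique (up U)   (up V)   _ len u≐v = Up-unique ≤-refl U V len u≐v
  side-unique (down U) (down V) _ len u≐v = Down-unique ≤-refl U V len u≐v
  side-unique empty    (down V) () _ _
  side-unique (up U)   (down V) () _ _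
  side-unique (down U) empty    () _ _
  side-unique (down U) (up V)   () _ _

  near⇒step : ∀ m n → ¬ (∣ m - n ∣ > 1) → m ≢ n → Step m n
  near⇒step zero          zero          near m≢n = contradiction refl m≢n
  near⇒step zero          (suc zero)    near m≢n = inj₁ refl
  near⇒step zero          (suc (suc n)) near m≢n = contradiction (s≤s (s≤s z≤n)) near
  near⇒step (suc zero)    zero          near m≢n = inj₂ refl
  near⇒step (suc (suc m)) zero          near m≢n = contradiction (s≤s (s≤s z≤n)) near
  near⇒step (suc m)       (suc n)       near m≢n =
    Sum.map (cong suc) (cong suc) (near⇒step m n near (m≢n ∘ cong suc))

  two-apart : ∀ m → ∣ m - suc (suc m) ∣ > 1
  two-apart m = subst (λ k → ∣ m - k ∣ > 1) (+-comm m 2) (≤-reflexive (sym (∣m-m+n∣≡n m 2)))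

  -- Two unit steps in opposite directions return to the start, so here both go the same way.
  two-steps : ∀ {a b c} → Step a b → Step b c → a ≢ c → ∣ a - c ∣ > 1
  two-steps {a} (inj₁ refl) (inj₁ refl) a≢c = two-apart a
  two-steps (inj₁ refl) (inj₂ refl) a≢c = contradiction refl a≢c
  two-steps (inj₂ refl) (inj₁ refl) a≢c = contradiction refl a≢c
  two-steps {c = c} (inj₂ refl) (inj₂ refl) a≢c = subst (_> 1) (∣-∣-comm c _) (two-apart c)

  Step-braid : ∀ {a b} → Step a b → ∀ x → swap a (swap b (swap a x)) ≡ swap b (swap a (swap b x))
  Step-braid {a} (inj₁ refl) x = swap-braid a x
  Step-braid {b = b} (inj₂ refl) x = sym (swap-braid b x)

  map-≡-++ : ∀ {A B : Set} (f : A → B) w x {y} → map f w ≡ x ++ y →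
    ∃[ x′ ] ∃[ y′ ] w ≡ x′ ++ y′ × map f y′ ≡ y
  map-≡-++ f w       []      eq = [] , w , refl , eq
  map-≡-++ f (a ∷ w) (b ∷ x) eq with x′ , y′ , refl , eq′ ← map-≡-++ f w x (∷-injectiveʳ eq) =
    a ∷ x′ , y′ , refl , eq′

  module _ {n : ℕ} where

    Step′ : Fin n → Fin n → Set
    Step′ = Step on toℕ

    Turn : Word n → Set
    Turn w = ∃[ x ] ∃[ a ] ∃[ b ] ∃[ c ] ∃[ y ] w ≡ x ++ a ∷ b ∷ c ∷ b ∷ a ∷ y × a ≢ c

    private
      TurnAtHead : Word n → Set
      TurnAtHead w = ∃[ a ] ∃[ b ] ∃[ c ] ∃[ y ] w ≡ a ∷ b ∷ c ∷ b ∷ a ∷ y × a ≢ c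

      turnAtHead? : ∀ w → Dec (TurnAtHead w)
      turnAtHead? []                = no λ { (_ , _ , _ , _ , () , _) }
      turnAtHead? (_ ∷ [])          = no λ { (_ , _ , _ , _ , () , _) }
      turnAtHead? (_ ∷ _ ∷ [])      = no λ { (_ , _ , _ , _ , () , _) }
      turnAtHead? (_ ∷ _ ∷ _ ∷ [])  = no λ { (_ , _ , _ , _ , () , _) }
      turnAtHead? (_ ∷ _ ∷ _ ∷ _ ∷ []) = no λ { (_ , _ , _ , _ , () , _) }
      turnAtHead? (a ∷ b ∷ c ∷ b′ ∷ a′ ∷ y) with b Fin.≟ b′ | a Fin.≟ a′ | a Fin.≟ c
      ... | yes refl | yes refl | no a≢c   = yes (a , b , c , y , refl , a≢c)
      ... | no b≢b′  | _        | _        = no λ { (_ , _ , _ , _ , refl , _) → b≢b′ refl }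
      ... | yes _    | no a≢a′  | _        = no λ { (_ , _ , _ , _ , refl , _) → a≢a′ refl }
      ... | yes _    | yes _    | yes refl = no λ { (_ , _ , _ , _ , refl , a≢a) → a≢a refl }

    turn? : ∀ w → Dec (Turn w)
    turn? [] = no λ { ([] , _ , _ , _ , _ , () , _) ; (_ ∷ _ , _ , _ , _ , _ , () , _) }
    turn? (i ∷ w) with turnAtHead? (i ∷ w) | turn? w
    ... | yes (a , b , c , y , eq , a≢c) | _ = yes ([] , a , b , c , y , eq , a≢c)
    ... | no _ | yes (x , a , b , c , y , refl , a≢c) = yes (i ∷ x , a , b , c , y , refl , a≢c)
    ... | no ¬head | no ¬turn = no λ
      { ([]    , a , b , c , y , eq , a≢c) → ¬head (a , b , c , y , eq , a≢c)
      ; (_ ∷ x , a , b , c , y , eq , a≢c) → ¬turn (x , a , b , c , y , ∷-injectiveʳ eq , a≢c)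
      }

    mix : ∀ {w} → Turn w → Word n
    mix (x , a , b , c , y , _) = x ++ a ∷ c ∷ b ∷ a ∷ c ∷ y

    Walk-prefix : ∀ (x : Word n) {a y} → Walk (x ++ a ∷ y) → Walk (x ++ [ a ])
    Walk-prefix []          l          = [-]
    Walk-prefix (_ ∷ [])    (near ∷ l) = near ∷ [-]
    Walk-prefix (_ ∷ _ ∷ x) (near ∷ l) = near ∷ Walk-prefix (_ ∷ x) l

    toℕ-NoZigzag : ∀ {w : Word n} → NoZigzag w → NoZigzag (map toℕ w)
    toℕ-NoZigzag {w} noZ x a b y eq with map-≡-++ toℕ w x eq
    ... | x′ , a₁ ∷ b₁ ∷ a₂ ∷ b₂ ∷ y′ , w≡ , eq′
      with refl ← toℕ-injective (trans (∷-injectiveˡ eq′) (sym (∷-injectiveˡ (∷-injectiveʳ (∷-injectiveʳ eq′)))))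
         | refl ← toℕ-injective (trans (∷-injectiveˡ (∷-injectiveʳ eq′))
                    (sym (∷-injectiveˡ (∷-injectiveʳ (∷-injectiveʳ (∷-injectiveʳ eq′))))))
      = noZ x′ a₁ b₁ y′ w≡

    toℕ-NoTurn : ∀ {w : Word n} → NoTurn w → NoTurn (map toℕ w)
    toℕ-NoTurn {w} noT x a b c y eq with map-≡-++ toℕ w x eq
    ... | x′ , a₁ ∷ b₁ ∷ c₁ ∷ b₂ ∷ a₂ ∷ y′ , w≡ , eq′
      with refl ← toℕ-injective (trans (∷-injectiveˡ eq′)
                    (sym (∷-injectiveˡ (∷-injectiveʳ (∷-injectiveʳ (∷-injectiveʳ (∷-injectiveʳ eq′)))))))
         | refl ← toℕ-injective (trans (∷-injectiveˡ (∷-injectiveʳ eq′))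
                    (sym (∷-injectiveˡ (∷-injectiveʳ (∷-injectiveʳ (∷-injectiveʳ eq′))))))
      = noT x′ a₁ b₁ c₁ y′ w≡

    -- Reduced words of a fixed permutation: forbidden factors and the treatment of turns.

    module _ (σ : Permutation′ (suc n)) where

      same-length : ∀ u v → IsReducedWord σ u → IsReducedWord σ v → length u ≡ length v
      same-length u v (σ≈u , u-min) (σ≈v , v-min) = ≤-antisym (u-min v σ≈v) (v-min u σ≈u)

      same-action : ∀ u v → IsReducedWord σ u → IsReducedWord σ v → u ≗ v
      same-action u v (σ≈u , _) (σ≈v , _) = ≈⇒≗ u v λ x → trans (sym (σ≈u x)) (σ≈v x)

      represents-≗ : ∀ u v → σ ≈ ⟦ u ⟧ → u ≗ v → σ ≈ ⟦ v ⟧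
      represents-≗ u v σ≈u u≗v x = trans (σ≈u x) (≗⇒≈ u v u≗v x)

      -- Factors of reduced words are reduced, since a shorter factor would shorten the whole word.
      no-shorter : ∀ x {u v : Word n} y → IsReducedWord σ (x ++ u ++ y) → u ≗ v → length u ≤ length v
      no-shorter x {u} {v} y (σ≈ , min) u≗v = +-cancelʳ-≤ (length y) _ _
        (subst₂ _≤_ (length-++ u) (length-++ v) (+-cancelˡ-≤ (length x) _ _
          (subst₂ _≤_ (length-++ x) (length-++ x)
            (min (x ++ v ++ y) (represents-≗ (x ++ u ++ y) (x ++ v ++ y) σ≈ (≗-context x {u} {v} y u≗v))))))

      no-repeat : ∀ {w} → IsReducedWord σ w → ∀ x {a} y → w ≢ x ++ a ∷ a ∷ y
      no-repeat red x {a} y refl =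
        contradiction (no-shorter x {a ∷ a ∷ []} {[]} y red λ p → swap-involutive (toℕ a) p) λ()

      -- `Walk` by itself allows equal neighbours; reducedness excludes them.
      walk⇒steps : ∀ {w} → IsReducedWord σ w → Walk w → Linked Step′ w
      walk⇒steps red l = go [] red l
        where
        -- The prefix `x` already passed is retained because reducedness is known for the whole
        -- word.
        go : ∀ x {y} → IsReducedWord σ (x ++ y) → Walk y → Linked Step′ y
        go x red []  = []
        go x red [-] = [-]
        go x {a ∷ b ∷ y} red (near ∷ l) =
          near⇒step _ _ (near ∘ far) (λ a≡b → no-repeat red x y
            (cong (λ c → x ++ a ∷ c ∷ y) (sym (toℕ-injective a≡b))))
          ∷ go (x ++ [ a ]) (subst (IsReducedWord σ) (sym (++-assoc x [ a ] _)) red) l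

      no-zigzag : ∀ {w} → IsReducedWord σ w → Walk w → NoZigzag w
      no-zigzag red l x a b y refl =
        contradiction (no-shorter x {a ∷ b ∷ a ∷ b ∷ []} {b ∷ a ∷ []} y red shorten) λ { (s≤s (s≤s ())) }
        where
        shorten : (a ∷ b ∷ a ∷ b ∷ []) ≗ (b ∷ a ∷ [])
        -- By a braid move and a cancellation, abab = babb = ba.
        shorten p = trans (Step-braid (linked-at x (walk⇒steps red l)) (swap (toℕ b) p))
          (cong (swap (toℕ b) ∘ swap (toℕ a)) (swap-involutive (toℕ b) p))

      turn-far : ∀ (x : Word n) {a b c y} → IsReducedWord σ (x ++ a ∷ b ∷ c ∷ y) → Walk (x ++ a ∷ b ∷ c ∷ y) →
        a ≢ c → Far a c
      turn-far x {a} {b} {c} {y} red l a≢c = far (two-steps (linked-at x steps)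
        (linked-at (x ++ [ a ]) (subst (Linked Step′) (sym (++-assoc x [ a ] _)) steps))
        (a≢c ∘ toℕ-injective))
        where steps = walk⇒steps red l

      mix-mixed : ∀ {w} → IsReducedWord σ w → Walk w → (t : Turn w) → Mixed (mix t)
      mix-mixed red l (x , a , b , c , y , refl , a≢c) =
        mixed x a c b y (Walk-prefix x l , turn-far x red l a≢c)

      -- x·abcba·y = x·acbca·y by a braid move, and ca commutes.
      mix-reduced : ∀ {w} → IsReducedWord σ w → Walk w → (t : Turn w) → IsReducedWord σ (mix t)
      mix-reduced red@(σ≈w , w-min) l (x , a , b , c , y , refl , a≢c) =
          represents-≗ (x ++ a ∷ b ∷ c ∷ b ∷ a ∷ y) (x ++ a ∷ c ∷ b ∷ a ∷ c ∷ y) σ≈w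
            (≗-context x {a ∷ b ∷ c ∷ b ∷ a ∷ []} {a ∷ c ∷ b ∷ a ∷ c ∷ []} y braid)
        , λ v σ≈v → subst (_≤ length v) same (w-min v σ≈v)
        where
        b-c : Step′ b c
        b-c = linked-at (x ++ [ a ]) (subst (Linked Step′) (sym (++-assoc x [ a ] _)) (walk⇒steps red l))
        braid : (a ∷ b ∷ c ∷ b ∷ a ∷ []) ≗ (a ∷ c ∷ b ∷ a ∷ c ∷ [])
        braid p = cong (swap (toℕ a)) (trans (Step-braid b-c (swap (toℕ a) p))
          (cong (swap (toℕ c) ∘ swap (toℕ b))
            (swap-comm (toℕ c) (toℕ a) p (Far.apart (Far-sym (turn-far x red l a≢c))))))
        same : length (x ++ a ∷ b ∷ c ∷ b ∷ a ∷ y) ≡ length (x ++ a ∷ c ∷ b ∷ a ∷ c ∷ y)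
        same = trans (length-++ x) (sym (length-++ x))

      -- The leftmost commuting pair of `mix t` reveals `x`, `a` and `c`; the letters behind it give
      -- `b` and `y`.
      mix-injective : ∀ {w w′} → IsReducedWord σ w → Walk w → (t : Turn w) →
        IsReducedWord σ w′ → Walk w′ → (t′ : Turn w′) → mix t ≡ mix t′ → w ≡ w′
      mix-injective red l (x , a , b , c , y , refl , a≢c) red′ l′ (x′ , a′ , b′ , c′ , y′ , refl , a′≢c′) eq
        with refl , refl , refl , refl ← firstFar-unique x x′
               (Walk-prefix x l , turn-far x red l a≢c) (Walk-prefix x′ l′ , turn-far x′ red′ l′ a′≢c′) eq
        = refl

      walk-shape : ∀ {w} → IsReducedWord σ w → Walk w → ¬ Turn w → Shape (map toℕ w)
      walk-shape {w} red l ¬turn = shape (map toℕ w) (Linked.map⁺ (walk⇒steps red l))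
        (toℕ-NoZigzag {w} noZ) (toℕ-NoTurn {w} noT)
        where
        noZ = no-zigzag red l
        noT : NoTurn w
        noT x a b c y eq with a Fin.≟ c
        ... | yes refl = noZ x a b (a ∷ y) eq
        ... | no a≢c   = ¬turn (x , a , b , c , y , eq , a≢c)

      -- Tokens and the classes they determine.

      data Token (w : Word n) : Word n ⊎ Fin 2 → Set where
        self     : Walk w → Token w (inj₁ w)
        turned   : Walk w → (t : Turn w) → Token w (inj₁ (mix t))
        straight : (S : Shape (map toℕ w)) → Token w (inj₂ (side S))
        other    : ∀ {v} → Unmixed w v → Token w (inj₁ v)

      -- The four kinds cannot collide: they are walks, mixed words, words of neither sort, and
      -- extra points. Within a kind the class is recovered from the word itself, by
      -- `mix-injective`, by the equivalence stored in `Unmixed`, or by `side-unique`.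
      Token-class : ∀ {w w′ t} → IsReducedWord σ w → IsReducedWord σ w′ → Token w t → Token w′ t → w ~ w′
      Token-class {w} {w′} red red′ T T′ = go T T′ refl
        where
        from-≡ : ∀ {u v : Word n} → u ≡ v → u ~ v
        from-≡ refl = ε
        -- `mix t` and `side S` are not constructor forms, so the two tokens get separate indices
        -- joined by an equation.
        go : ∀ {t t′} → Token w t → Token w′ t′ → t ≡ t′ → w ~ w′
        go (self _)       (self _)                   refl = ε
        go (self l)       (turned l′ t′)             refl = ⊥-elim (mixed⇒¬Walk (mix-mixed red′ l′ t′) l)
        go (turned l t)   (self l′)                  refl = ⊥-elim (mixed⇒¬Walk (mix-mixed red l t) l′)
        go (self l)       (other (unmixed _ ¬l _))   refl = ⊥-elim (¬l l)
        go (other (unmixed _ ¬l _)) (self l)         refl = ⊥-elim (¬l l)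
        go (turned l t)   (turned l′ t′)             eq   =
          from-≡ (mix-injective red l t red′ l′ t′ (inj₁-injective eq))
        go (turned l t)   (other (unmixed _ _ ¬M))   refl = ⊥-elim (¬M (mix-mixed red l t))
        go (other (unmixed _ _ ¬M)) (turned l t)     refl = ⊥-elim (¬M (mix-mixed red′ l t))
        go (other U)      (other U′)                 refl = Unmixed.equivalent U ◅◅ ~-sym (Unmixed.equivalent U′)
        go (straight S)   (straight S′)              eq   = from-≡ (map-injective toℕ-injective
          (side-unique S S′ (inj₂-injective eq)
            (trans (length-map toℕ w) (trans (same-length w w′ red red′) (sym (length-map toℕ w′))))
            (same-action w w′ red red′)))

      swap-reduced : ∀ x (a b : Fin n) y → ∣ toℕ a - toℕ b ∣ > 1 →
        IsReducedWord σ (x ++ a ∷ b ∷ y) → IsReducedWord σ (x ++ b ∷ a ∷ y)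
      swap-reduced x a b y f (σ≈ , min) =
          represents-≗ (x ++ a ∷ b ∷ y) (x ++ b ∷ a ∷ y) σ≈
            (≗-context x {a ∷ b ∷ []} {b ∷ a ∷ []} y λ p → swap-comm (toℕ a) (toℕ b) p f)
        , λ v σ≈v → subst (_≤ length v) (trans (length-++ x) (sym (length-++ x))) (min v σ≈v)

      ~-reduced : ∀ {u v} → u ~ v → IsReducedWord σ u → IsReducedWord σ v
      ~-reduced ε red = red
      ~-reduced (fwd (commute x {a} {b} y f) ◅ rest) red = ~-reduced rest (swap-reduced x a b y f red)
      ~-reduced (bwd (commute x {a} {b} y f) ◅ rest) red =
        ~-reduced rest (swap-reduced x b a y (Far.apart (Far-sym (far {i = a} {b} f))) red)

      -- Like the equality of `R`, the comparison of tokens ignores proofs of reducedness.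
      strip : ReducedWord σ ⊎ Fin 2 → Word n ⊎ Fin 2
      strip = Sum.map₁ proj₁

      tokens : (X : ReducedWord σ) → ∃[ t ] ∃[ t′ ]
        Token (proj₁ X) (strip t) × Token (proj₁ X) (strip t′) × strip t ≢ strip t′
      tokens X@(w , red) with walk? w
      ... | no ¬l with p , q , P , Q , p≢q ← pair w ¬l =
          inj₁ (p , ~-reduced (Unmixed.equivalent P) red) , inj₁ (q , ~-reduced (Unmixed.equivalent Q) red)
        , other P , other Q , p≢q ∘ inj₁-injective
      ... | yes l with turn? w
      ...   | yes t = inj₁ X , inj₁ (mix t , mix-reduced red l t) , self l , turned l t
                    , λ eq → mixed⇒¬Walk (mix-mixed red l t) (subst Walk (inj₁-injective eq) l)
      ...   | no ¬t = inj₁ X , inj₂ (side (walk-shape red l ¬t)) , self l , straight _ , λ ()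

      -- Counting two tokens per class.

      module _ {r c : ℕ} (R-r : HasCardinality (R σ) r) (C-c : HasCardinality (C σ) c) where

        private
          module R = Bijection R-r
          module C = Bijection C-c

        representative : Fin c → ReducedWord σ
        representative i = proj₁ (C.surjective i)

        representative-injective : ∀ i j → proj₁ (representative i) ~ proj₁ (representative j) → i ≡ j
        representative-injective i j eq = begin
          i                         ≡⟨ proj₂ (C.surjective i) ε ⟨
          C.to (representative i)   ≡⟨ C.cong eq ⟩
          C.to (representative j)   ≡⟨ proj₂ (C.surjective j) ε ⟩
          j                         ∎
          where open ≡-Reasoning

        token : Fin c → Fin 2 → ReducedWord σ ⊎ Fin 2
        token i zero       = proj₁ (tokens (representative i))
        token i (suc zero) = proj₁ (proj₂ (tokens (representative i)))

        isToken : ∀ i k → Token (proj₁ (representative i)) (strip (token i k))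
        isToken i zero       = proj₁ (proj₂ (proj₂ (tokens (representative i))))
        isToken i (suc zero) = proj₁ (proj₂ (proj₂ (proj₂ (tokens (representative i)))))

        -- Equal tokens have equivalent representatives, hence come from one class, and the two
        -- tokens of a class are distinct.
        token-injective : ∀ i k j l → strip (token i k) ≡ strip (token j l) → (i , k) ≡ (j , l)
        token-injective i k j l eq
          with refl ← representative-injective i j (Token-class
                        (proj₂ (representative i)) (proj₂ (representative j))
                        (isToken i k) (subst (Token _) (sym eq) (isToken j l)))
          = cong (i ,_) (same k l eq)
          where
          distinct = proj₂ (proj₂ (proj₂ (proj₂ (tokens (representative i)))))
          same : ∀ k l → strip (token i k) ≡ strip (token i l) → k ≡ l
          same zero       zero       _  = refl
          same zero       (suc zero) eq = contradiction eq distinct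
          same (suc zero) zero       eq = contradiction (sym eq) distinct
          same (suc zero) (suc zero) _  = refl

        strip-injective : ∀ s t → Sum.map₁ R.to s ≡ Sum.map₁ R.to t → strip s ≡ strip t
        strip-injective (inj₁ _) (inj₁ _) eq = cong inj₁ (R.injective (inj₁-injective eq))
        strip-injective (inj₂ _) (inj₂ _) eq = cong inj₂ (inj₂-injective eq)

        c*2≤r+2 : c * 2 ≤ r + 2
        c*2≤r+2 = injective⇒≤ {f = Inverse.from +↔⊎ ∘ encode ∘ Inverse.to *↔×}
          (Injection.injective (↔⇒↣ *↔×) ∘ encode-injective ∘ Injection.injective (↔⇒↣ (↔-sym +↔⊎)))
          where
          encode : Fin c × Fin 2 → Fin r ⊎ Fin 2
          encode (i , k) = Sum.map₁ R.to (token i k)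
          encode-injective : ∀ {p q} → encode p ≡ encode q → p ≡ q
          encode-injective {i , k} {j , l} eq =
            token-injective i k j l (strip-injective (token i k) (token j l) eq)

  -- Passage to the inequality between rationals.

  halve : ∀ c r → c * 2 ≤ r + 2 → (+ c) / 1 ℚ.≤ ½ ℚ.* ((+ r) / 1) ℚ.+ 1ℚ
  halve c r c*2≤r+2 = ℚ.toℚᵘ-cancel-≤ (begin
    ℚ.toℚᵘ ((+ c) / 1)                                  ≃⟨ ℚ.toℚᵘ-fromℚᵘ (mkℚᵘ (+ c) 0) ⟩
    mkℚᵘ (+ c) 0                                        ≤⟨ *≤* bound ⟩
    ℚᵘ.½ ℚᵘ.* mkℚᵘ (+ r) 0 ℚᵘ.+ ℚᵘ.1ℚᵘ                   ≃⟨ ℚᵘ.+-congˡ ℚᵘ.1ℚᵘ (ℚᵘ.*-congˡ {ℚᵘ.½} (ℚ.toℚᵘ-fromℚᵘ (mkℚᵘ (+ r) 0))) ⟨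
    ℚᵘ.½ ℚᵘ.* ℚ.toℚᵘ ((+ r) / 1) ℚᵘ.+ ℚᵘ.1ℚᵘ             ≃⟨ ℚᵘ.+-congˡ ℚᵘ.1ℚᵘ (ℚ.toℚᵘ-homo-* ½ ((+ r) / 1)) ⟨
    ℚ.toℚᵘ (½ ℚ.* ((+ r) / 1)) ℚᵘ.+ ℚᵘ.1ℚᵘ              ≃⟨ ℚ.toℚᵘ-homo-+ (½ ℚ.* ((+ r) / 1)) 1ℚ ⟨
    ℚ.toℚᵘ (½ ℚ.* ((+ r) / 1) ℚ.+ 1ℚ)                   ∎)
    where
    open ℚᵘ.≤-Reasoning
    numerator : ((+ 1 ℤ.* + r) ℤ.* + 1 ℤ.+ + 1 ℤ.* + 2) ℤ.* + 1 ≡ + (r + 2)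
    numerator = trans (ℤ.*-identityʳ _)
      (cong (ℤ._+ + 2) (trans (ℤ.*-identityʳ _) (ℤ.*-identityˡ (+ r))))
    -- The cross-multiplied inequality of unnormalised fractions: the left denominator is 1 and the
    -- right one is 2.
    bound : + c ℤ.* + 2 ℤ.≤ ((+ 1 ℤ.* + r) ℤ.* + 1 ℤ.+ + 1 ℤ.* + 2) ℤ.* + 1
    bound = subst₂ ℤ._≤_ (ℤ.pos-* c 2) (sym numerator) (ℤ.+≤+ c*2≤r+2)

open ReducedWords
open CommutationClasses
open Counting
open import Data.Rational using (_/_; _≤_; _+_; _*_; ½; 1ℚ)

theoremB : (n : ℕ) → 1 ≤ℕ n → (σ : Permutation′ (suc n)) →
    ∃[ r ] ∃[ c ] (HasCardinality (R σ) r × HasCardinality (C σ) c ×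
    (+ c) / 1 ≤ ½ * ((+ r) / 1) + 1ℚ)
theoremB n _ σ =
  let r , R-r = finite (isReducedWord? σ) isEquivalence (≡-dec Fin._≟_) (reducedWords σ) (∈-reducedWords σ)
      c , C-c = finite (isReducedWord? σ) (EqC.isEquivalence Commutation) _~?_ (reducedWords σ) (∈-reducedWords σ)
  in r , c , R-r , C-c , halve c r (c*2≤r+2 σ R-r C-c)
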